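{- Let $G$ be a finite, simple, connected graph such that every block of $G$ is a cycle. Then $$2\, W(G) \leq \mathrm{Sz}^*(G),$$ with equality if and only if every cycle in $G$ has even length.
   Context: A block is a maximal 2-connected subgraph in the sense of the block-cut-vertex decomposition, where a bridge together with its two end points counts as a block (so the hypothesis excludes bridges), and distinct blocks overlap only in cut vertices. $V(G)$ and $E(G)$ are the vertex and edge sets; $d_G(u,v)$ is the length of a shortest path between $u$ and $v$. The Wiener index is $$W(G) = \sum_{\{u,v\} \subseteq V(G)} d_G(u,v) = \tfrac12 \sum_{u,v \in V(G)} d_G(u,v).$$ For vertices $s,t$, $n_G(s,t)$ is the number of vertices $w$ of $G$ with $d_G(w,s) < d_G(w,t)$, and $o_G(s,t)$ is the number of vertices $w$ with $d_G(w,s) = d_G(w,t)$. The revised Szeged index is $$\mathrm{Sz}^*(G) = \sum_{\{s,t\} \in E(G)} \left(n_G(s,t) + \tfrac12 o_G(s,t)\right)\left(n_G(t,s) + \tfrac12 o_G(t,s)\right).$$ -}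

module Defs where

open import Level using (0ℓ)
open import Data.Bool.Base using (if_then_else_)
open import Data.Fin.Base using (Fin; toℕ)
import Data.Fin.Properties as Fin
open import Data.Fin.Subset using (Subset; _∈_; _⊆_; _∪_; _-_; ⁅_⁆; ⊤; ∣_∣; Nonempty)
open import Data.Fin.Subset.Properties using (∈⊤)
open import Data.Integer.Base using (+_)
open import Data.List.Base using (length; filter; allFin)
open import Data.Nat.Base using (ℕ; zero; suc; _≤_; _<_; z≤n; s≤s; s≤s⁻¹)
import Data.Nat.Properties as ℕ
open import Data.Product.Base using (∃-syntax; _×_; _,_; proj₁; proj₂)
open import Data.Rational.Base using (ℚ; ½; 0ℚ; _+_; _*_; _/_)
import Data.Rational.Properties as ℚ
open import Data.Sum.Base using (_⊎_; inj₁; inj₂)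
open import Data.Vec.Base using (Vec; []; _∷_; lookup)
import Data.Vec.Membership.Propositional as Vec
open import Data.Vec.Relation.Unary.All as All using (All; []; _∷_)
open import Data.Vec.Relation.Unary.Any using (here; there)
open import Data.Vec.Relation.Unary.Unique.Propositional using (Unique; []; _∷_)
open import Data.Vec.Relation.Unary.Unique.Propositional.Properties using (lookup-injective)
open import Function.Base using (_∘_)
open import Function.Bundles using (_⇔_)
open import Function.Definitions using (Injective)
open import Relation.Binary.Core using (Rel; _⇒_)
open import Relation.Binary.Definitions using (Decidable; Symmetric; Irreflexive)
open import Relation.Binary.PropositionalEquality.Core using (_≡_; _≢_; refl)
open import Relation.Nullary using (Dec; yes; no; does; ¬_; contradiction; _×-dec_)
import Relation.Nullary.Decidable as Dec
import Relation.Unary as U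
import Algebra.Properties.CommutativeMonoid.Sum as Sum

open Sum ℕ.+-0-commutativeMonoid using () renaming (sum to sumℕ) public
open Sum ℚ.+-0-commutativeMonoid using () renaming (sum to sumℚ) public

------------------------------------------------------------------------
-- Finite simple graphs and their subgraphs

record Graph (n : ℕ) : Set₁ where
  infix 4 _~_ _~?_
  field
    _~_      : Rel (Fin n) 0ℓ
    _~?_     : Decidable _~_
    ~-sym    : Symmetric _~_
    ~-irrefl : Irreflexive _≡_ _~_

record Subgraph {n : ℕ} (G : Graph n) : Set₁ where
  open Graph G
  field
    V      : Subset n
    E      : Rel (Fin n) 0ℓ
    E?     : Decidable E
    E-sym  : Symmetric E
    E⇒~    : E ⇒ _~_
    E-in-V : ∀ {u v} → E u v → u ∈ V

infix 4 _⊑_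
_⊑_ : ∀ {n} {G : Graph n} → Subgraph G → Subgraph G → Set
H ⊑ K = Subgraph.V H ⊆ Subgraph.V K × Subgraph.E H ⇒ Subgraph.E K

------------------------------------------------------------------------
-- Walks, paths, connectedness

infixr 5 _∷_
data Walk {A : Set} (R : Rel A 0ℓ) : ℕ → A → A → Set where
  []  : ∀ {u} → Walk R 0 u u
  _∷_ : ∀ {k u v w} → R u v → Walk R k v w → Walk R (suc k) u w

vertices : ∀ {A R k} {u v : A} → Walk R k u v → Vec A (suc k)
vertices {u = u} []      = u ∷ []
vertices {u = u} (_ ∷ p) = u ∷ vertices p

Path : {A : Set} (R : Rel A 0ℓ) → ℕ → A → A → Set
Path R k u v = ∃[ p ] Unique (vertices {R = R} {k} {u} {v} p)

Joined : {A : Set} (R : Rel A 0ℓ) → Rel A 0ℓ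
Joined R u v = ∃[ k ] Walk R k u v

-- Connectedness of the graph with vertex set S and edge relation R.  It is
-- only used when R relates elements of S to each other.
ConnectedOn : ∀ {n} → Subset n → Rel (Fin n) 0ℓ → Set
ConnectedOn S R = Nonempty S × (∀ {u v} → u ∈ S → v ∈ S → Joined R u v)

Connected : ∀ {n} → Graph n → Set
Connected G = ConnectedOn ⊤ (Graph._~_ G)

------------------------------------------------------------------------
-- Blocks

module _ {n : ℕ} {G : Graph n} where
  open Graph G

  -- More than two vertices, connected, and still connected after the
  -- deletion of any one vertex.
  TwoConnected : Subgraph G → Set
  TwoConnected H =
    2 < ∣ V ∣ × ConnectedOn V E ×
    (∀ {x} → x ∈ V → ConnectedOn (V - x) (λ u v → E u v × u ≢ x × v ≢ x))
    where open Subgraph H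

  MaximalTwoConnected : Subgraph G → Set₁
  MaximalTwoConnected H =
    TwoConnected H × (∀ K → TwoConnected K → H ⊑ K → K ⊑ H)

  -- st is an edge whose deletion separates s from t.
  Bridge : Rel (Fin n) 0ℓ
  Bridge s t = s ~ t × ¬ Joined G-st s t
    where
    G-st : Rel (Fin n) 0ℓ
    G-st u v = u ~ v × ¬ ((u ≡ s × v ≡ t) ⊎ (u ≡ t × v ≡ s))

  -- A bridge together with its two end points.
  BridgeSubgraph : Subgraph G → Set
  BridgeSubgraph H = ∃[ s ] ∃[ t ] Bridge s t × V ≡ ⁅ s ⁆ ∪ ⁅ t ⁆ × E s t
    where open Subgraph H

  Block : Subgraph G → Set₁
  Block H = MaximalTwoConnected H ⊎ BridgeSubgraph H

------------------------------------------------------------------------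
-- Cycles

-- j follows i in the cyclic order 0, 1, …, k-1, 0.
CyclicSuc : ∀ {k} → Rel (Fin k) 0ℓ
CyclicSuc {k} i j =
  toℕ j ≡ suc (toℕ i) ⊎ (toℕ j ≡ 0 × suc (toℕ i) ≡ k)

module _ {n : ℕ} {G : Graph n} where

  -- C is the cycle c 0, c 1, …, c (k-1), c 0.
  CycleOfLength : ℕ → Subgraph G → Set
  CycleOfLength k C =
    3 ≤ k × ∃[ c ] Injective {A = Fin k} _≡_ _≡_ c
      × (∀ v → v ∈ V ⇔ (∃[ i ] c i ≡ v))
      × (∀ i j → E (c i) (c j) ⇔ (CyclicSuc i j ⊎ CyclicSuc j i))
    where open Subgraph C

  Cycle : Subgraph G → Set
  Cycle C = ∃[ k ] CycleOfLength k C

------------------------------------------------------------------------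
-- Distance

-- The least k < b satisfying P, or b if there is none.
least : {P : ℕ → Set} → U.Decidable P → ℕ → ℕ
least P? zero    = 0
least P? (suc b) = if does (P? 0) then 0 else suc (least (P? ∘ suc) b)

module _ {n : ℕ} {R : Rel (Fin n) 0ℓ} (R? : Decidable R) where

  walk? : ∀ k u v → Dec (Walk R k u v)
  walk? zero    u v = Dec.map′ (λ { refl → [] }) (λ { [] → refl }) (u Fin.≟ v)
  walk? (suc k) u v =
    Dec.map′ (λ (_ , r , p) → r ∷ p) (λ { (r ∷ p) → _ , r , p })
             (Fin.any? (λ w → R? u w ×-dec walk? k w v))

-- The search bound n is never attained in a connected graph: a shortest walk
-- has no repeated vertex.  See dist-path and dist-shortest below.
dist : ∀ {n} → Graph n → Fin n → Fin n → ℕ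
dist {n} G u v = least (λ k → walk? (Graph._~?_ G) k u v) n

private
  least-≤ : ∀ {P : ℕ → Set} (P? : U.Decidable P) b {k} → P k → least P? b ≤ k
  least-≤ P? zero    pk = z≤n
  least-≤ P? (suc b) {k} pk with P? 0
  ... | yes _ = z≤n
  least-≤ P? (suc b) {zero}  pk | no ¬p0 = contradiction pk ¬p0
  least-≤ P? (suc b) {suc k} pk | no _   = s≤s (least-≤ (P? ∘ suc) b pk)

  least-sat : ∀ {P : ℕ → Set} (P? : U.Decidable P) b {k} → k ≤ b → P k → P (least P? b)
  least-sat P? zero    z≤n pk = pk
  least-sat P? (suc b) k≤b pk with P? 0
  ... | yes p0 = p0
  least-sat P? (suc b) {zero}  k≤b pk | no ¬p0 = contradiction pk ¬p0
  least-sat P? (suc b) {suc k} k≤b pk | no _   = least-sat (P? ∘ suc) b (s≤s⁻¹ k≤b) pk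

  module _ {A : Set} {R : Rel A 0ℓ} where

    suffix : ∀ {k} {u v x : A} (p : Walk R k u v) → x Vec.∈ vertices p →
             ∃[ j ] j ≤ k × Walk R j x v
    suffix []      (here refl) = 0 , z≤n , []
    suffix (r ∷ p) (here refl) = _ , ℕ.≤-refl , r ∷ p
    suffix (r ∷ p) (there x∈p) with j , j≤k , q ← suffix p x∈p = j , ℕ.m≤n⇒m≤1+n j≤k , q

    ∉⇒All≢ : ∀ {m x} (ys : Vec A m) → ¬ (x Vec.∈ ys) → All (x ≢_) ys
    ∉⇒All≢ []       x∉ = []
    ∉⇒All≢ (y ∷ ys) x∉ = (x∉ ∘ here) ∷ ∉⇒All≢ ys (x∉ ∘ there)

    shortest⇒unique : ∀ {k u v} (p : Walk R k u v) →
                      (∀ {j} → Walk R j u v → k ≤ j) → Unique (vertices p)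
    shortest⇒unique []      min = [] ∷ []
    shortest⇒unique (r ∷ p) min =
      ∉⇒All≢ (vertices p) (λ u∈p → let j , j≤k , q = suffix p u∈p in
        ℕ.<-irrefl refl (ℕ.≤-trans (min q) j≤k))
      ∷ shortest⇒unique p (λ q → s≤s⁻¹ (min (r ∷ q)))

module _ {n : ℕ} (G : Graph n) where
  open Graph G

  dist-shortest : ∀ {k u v} → Walk _~_ k u v → dist G u v ≤ k
  dist-shortest = least-≤ (λ k → walk? _~?_ k _ _) n

  dist-path : Connected G → ∀ u v → Path _~_ (dist G u v) u v
  dist-path (_ , joined) u v = p , shortest⇒unique p dist-shortest
    where
    W? : ∀ k → Dec (Walk _~_ k u v)
    W? k = walk? _~?_ k u v

    b m : ℕ
    b = proj₁ (joined {u} {v} ∈⊤ ∈⊤)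
    m = least W? b

    q : Walk _~_ m u v
    q = least-sat W? b ℕ.≤-refl (proj₂ (joined ∈⊤ ∈⊤))

    m<n : m < n
    m<n = Fin.injective⇒≤ {f = lookup (vertices q)}
      (lookup-injective (shortest⇒unique q (least-≤ W? b)) _ _)

    p : Walk _~_ (dist G u v) u v
    p = least-sat W? n (ℕ.<⇒≤ m<n) q

------------------------------------------------------------------------
-- The two indices

⟦_⟧ : ℕ → ℚ
⟦ k ⟧ = + k / 1

module _ {n : ℕ} (G : Graph n) where
  open Graph G

  -- An unordered pair {u,v} is represented by the ordered pair with u < v.
  Wiener : ℕ
  Wiener = sumℕ λ u → sumℕ λ v → if does (u Fin.<? v) then dist G u v else 0

  closer : Fin n → Fin n → ℕ
  closer s t = length (filter (λ w → dist G w s ℕ.<? dist G w t) (allFin n))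

  equidistant : Fin n → Fin n → ℕ
  equidistant s t = length (filter (λ w → dist G w s ℕ.≟ dist G w t) (allFin n))

  share : Fin n → Fin n → ℚ
  share s t = ⟦ closer s t ⟧ + ½ * ⟦ equidistant s t ⟧

  RevisedSzeged : ℚ
  RevisedSzeged = sumℚ λ s → sumℚ λ t →
    if does (s Fin.<? t ×-dec s ~? t) then share s t * share t s else 0ℚ

{-# OPTIONS --safe #-}
module Submission where

-- Write d for the distance.  For an oriented edge st put f(x) = d(x,t) − d(x,s),
-- so that f(x) ∈ {−1, 0, 1}.  Then 2 n(s,t) + o(s,t) = Σ_x (1 + f(x)), whence
-- 8 Sz* = Σ_{x,y} F(x,y), where F(x,y) sums (1 + f(x)) (1 − f(y)) over the oriented
-- edges, while 16 W = Σ_{x,y} 8 d(x,y).  The comparison holds term by term.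
--
-- Lower bound: (1 + f(x)) (1 − f(y)) ≥ 2 max(0, f(x) − f(y)), and f(x) − f(y) is the
-- increment along st of the potential d(x,·) − d(y,·), which rises by 2 d(x,y) from x
-- to y.  As there are no bridges, each of its level cuts has at least two edges.
--
-- Equality forces F(x,x) = 0, that is, f never vanishes; then the parity of d(x,·)
-- alternates along every cycle.  Conversely, if all cycles are even then f never
-- vanishes, because two geodesics from the ends of an edge st with f(x) = 0 would
-- close up to an odd cycle.  Moving y to a neighbour y′ then increases F(x,y) by at
-- most 4 for each edge st with s nearer to y and t nearer to y′.  Every such edge
-- other than yy′ lies with yy′ on a cycle made of geodesics s → y and t → y′ which
-- contains no third such edge.  All these cycles share y and y′; the union of two of
-- them is 2-connected, so lies in a block, which is a cycle, and they coincide.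
-- Hence there are at most two such edges and F(x,y′) ≤ F(x,y) + 8.

open import Defs
open import Level using (0ℓ)
open import Data.Bool.Base using (true; false; if_then_else_; _∧_)
open import Data.Empty using (⊥)
open import Data.Fin.Base using (Fin; zero; suc; toℕ; fromℕ; fromℕ<; inject₁)
import Data.Fin.Properties as Fin
open import Data.Fin.Subset using (Subset; _∈_; _∉_; _∪_; _-_; ⁅_⁆; ∣_∣)
open import Data.Fin.Subset.Properties
  using ( x∈⁅x⁆; x∈⁅y⁆⇒x≡y; x∈p∪q⁺; x∈p∪q⁻; _∈?_; p─q⊆p; p─q─q≡p─q
        ; x∈p∧x≢y⇒x∈p-y; x∈p⇒∣p-x∣<∣p∣; ∣p∣≤∣p∪q∣; p⊆p∪q; p⊆q⇒∣p∣≤∣q∣; p⊂q⇒∣p∣<∣q∣; ∣p∣≤n )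
import Data.Integer.Base as ℤ
import Data.Integer.Properties as ℤ
open import Data.List.Base using (length; filter)
import Data.List.Base as List
open import Data.Nat.Base
  using (ℕ; zero; suc; pred; _+_; _*_; _∸_; _≤_; _<_; z≤n; s≤s; s≤s⁻¹)
open import Data.Nat.Divisibility using (_∣_; divides; ∣m∣n⇒∣m+n; ∣m+n∣m⇒∣n; ∣⇒≤; ∣-refl)
open import Data.Nat.Induction using (<-wellFounded)
open import Data.Nat.Properties
open import Data.Nat.Solver using (module +-*-Solver)
open import Data.Product.Base using (∃-syntax; _×_; _,_; proj₁; proj₂)
open import Data.Rational.Base as ℚ using (ℚ; ½; 0ℚ; 1ℚ)
import Data.Rational.Properties as ℚ
import Data.Rational.Unnormalised.Base as ℚᵘ
import Data.Rational.Unnormalised.Properties as ℚᵘ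
open import Data.Sum.Base as Sum using (_⊎_; inj₁; inj₂)
open import Data.Unit.Base using (tt) renaming (⊤ to Unit)
open import Data.Vec.Base using (tabulate)
open import Data.Vec.Properties using (lookup∘tabulate; lookup⇒[]=; []=⇒lookup)
open import Function.Base using (_∘_; id)
open import Function.Bundles using (Equivalence; _⇔_; mk⇔)
open import Function.Definitions using (Injective)
open import Induction.WellFounded using (Acc; acc)
open import Relation.Binary.Core using (Rel; _⇒_)
open import Relation.Binary.Definitions using (Symmetric; tri<; tri≈; tri>)
open import Relation.Binary.PropositionalEquality hiding ([_])
open import Relation.Nullary
open import Relation.Nullary.Decidable using (decidable-stable; dec-true; dec-false)
import Relation.Unary as Unary
open import Algebra.Properties.CommutativeMonoid.Sum +-0-commutativeMonoid
  using (sum-cong-≗; ∑-distrib-+; ∑-comm; sum-replicate-zero)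
open import Algebra.Properties.Semiring.Sum +-*-semiring using (*-distribˡ-sum; *-distribʳ-sum)

-- Finite sums of natural numbers

[_] : {P : Set} → Dec P → ℕ
[ P? ] = if does P? then 1 else 0

[]-yes : {P : Set} (P? : Dec P) → P → [ P? ] ≡ 1
[]-yes (yes _) p = refl
[]-yes (no ¬p) p = contradiction p ¬p

[]-no : {P : Set} (P? : Dec P) → ¬ P → [ P? ] ≡ 0
[]-no (yes p) ¬p = contradiction p ¬p
[]-no (no _)  ¬p = refl

[]-≤1 : ∀ {P : Set} (P? : Dec P) → [ P? ] ≤ 1
[]-≤1 (yes _) = ≤-refl
[]-≤1 (no _)  = z≤n

[]-mono : ∀ {P Q : Set} (P? : Dec P) (Q? : Dec Q) → (P → Q) → [ P? ] ≤ [ Q? ]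
[]-mono (no _)  _  f = z≤n
[]-mono (yes p) Q? f = ≤-reflexive (sym ([]-yes Q? (f p)))

sum-mono-≤ : ∀ {n} {f g : Fin n → ℕ} → (∀ i → f i ≤ g i) → sumℕ f ≤ sumℕ g
sum-mono-≤ {zero}  f≤g = z≤n
sum-mono-≤ {suc n} f≤g = +-mono-≤ (f≤g zero) (sum-mono-≤ (f≤g ∘ suc))

-- The tails are ordered the same way as the heads, so a deficit at the head could not be made up
-- later.
sum-mono-≤-≡ : ∀ {n} {f g : Fin n → ℕ} → (∀ i → f i ≤ g i) → sumℕ f ≡ sumℕ g →
               ∀ i → f i ≡ g i
sum-mono-≤-≡ {suc n} {f} {g} f≤g eq = λ
  { zero    → f0≡g0
  ; (suc i) → sum-mono-≤-≡ (f≤g ∘ suc)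
                (+-cancelˡ-≡ (f zero) _ _ (trans eq (cong (_+ _) (sym f0≡g0)))) i }
  where
  f0≡g0 : f zero ≡ g zero
  f0≡g0 = ≤-antisym (f≤g zero) (+-cancelʳ-≤ (sumℕ (f ∘ suc)) _ _ (begin
    g zero + sumℕ (f ∘ suc) ≤⟨ +-monoʳ-≤ (g zero) (sum-mono-≤ (f≤g ∘ suc)) ⟩
    sumℕ g                  ≡⟨ eq ⟨
    sumℕ f                  ∎))
    where open ≤-Reasoning

sum-indicator : ∀ {n} (a : Fin n) → sumℕ (λ i → [ i Fin.≟ a ]) ≡ 1
sum-indicator {suc n} zero    = cong suc (sum-replicate-zero n)
sum-indicator {suc n} (suc a) = trans (sum-cong-≗ {n} shift) (sum-indicator a)
  where
  shift : ∀ i → [ suc i Fin.≟ suc a ] ≡ [ i Fin.≟ a ]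
  shift i with i Fin.≟ a
  ... | yes _ = refl
  ... | no  _ = refl

length-filter : ∀ {n} {A : Set} {P : A → Set} (P? : Unary.Decidable P) (f : Fin n → A) →
                length (filter P? (List.tabulate f)) ≡ sumℕ (λ i → [ P? (f i) ])
length-filter {zero}  P? f = refl
length-filter {suc n} P? f with does (P? (f zero))
... | true  = cong suc (length-filter P? (f ∘ suc))
... | false = length-filter P? (f ∘ suc)

∑∑ : ∀ {n} → (Fin n → Fin n → ℕ) → ℕ
∑∑ f = sumℕ λ s → sumℕ λ t → f s t

module _ {n : ℕ} where

  ∑∑-cong : {f g : Fin n → Fin n → ℕ} → (∀ s t → f s t ≡ g s t) → ∑∑ f ≡ ∑∑ g
  ∑∑-cong f≡g = sum-cong-≗ {n} λ s → sum-cong-≗ {n} (f≡g s)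

  ∑∑-mono-≤ : {f g : Fin n → Fin n → ℕ} → (∀ s t → f s t ≤ g s t) → ∑∑ f ≤ ∑∑ g
  ∑∑-mono-≤ f≤g = sum-mono-≤ λ s → sum-mono-≤ (f≤g s)

  ∑∑-mono-≤-≡ : {f g : Fin n → Fin n → ℕ} → (∀ s t → f s t ≤ g s t) → ∑∑ f ≡ ∑∑ g →
                ∀ s t → f s t ≡ g s t
  ∑∑-mono-≤-≡ f≤g eq s =
    sum-mono-≤-≡ (f≤g s) (sum-mono-≤-≡ (λ s → sum-mono-≤ (f≤g s)) eq s)

  ∑∑-+ : (f g : Fin n → Fin n → ℕ) → ∑∑ (λ s t → f s t + g s t) ≡ ∑∑ f + ∑∑ g
  ∑∑-+ f g = trans (sum-cong-≗ {n} λ s → ∑-distrib-+ {n} (f s) (g s))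
                   (∑-distrib-+ {n} (λ s → sumℕ (f s)) (λ s → sumℕ (g s)))

  ∑∑-* : ∀ k (f : Fin n → Fin n → ℕ) → ∑∑ (λ s t → k * f s t) ≡ k * ∑∑ f
  ∑∑-* k f = trans (sum-cong-≗ {n} λ s → sym (*-distribˡ-sum {n} k (f s)))
                   (sym (*-distribˡ-sum {n} k (λ s → sumℕ (f s))))

  sum-*-sum : (f g : Fin n → ℕ) → sumℕ f * sumℕ g ≡ ∑∑ (λ x y → f x * g y)
  sum-*-sum f g = trans (*-distribʳ-sum {n} (sumℕ g) f)
                        (sum-cong-≗ {n} λ x → *-distribˡ-sum {n} (f x) g)

  -- This moves the sum over pairs of vertices outside the sum over edges; each step exchanges two
  -- neighbouring sums.
  ∑∑-swap : (h : Fin n → Fin n → Fin n → Fin n → ℕ) →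
            ∑∑ (λ s t → ∑∑ (h s t)) ≡ ∑∑ (λ x y → ∑∑ (λ s t → h s t x y))
  ∑∑-swap h = begin
    sumℕ (λ s → sumℕ λ t → sumℕ λ x → sumℕ λ y → h s t x y)
      ≡⟨ sum-cong-≗ {n} (λ s → ∑-comm {n} {n} _) ⟩
    sumℕ (λ s → sumℕ λ x → sumℕ λ t → sumℕ λ y → h s t x y)
      ≡⟨ ∑-comm {n} {n} _ ⟩
    sumℕ (λ x → sumℕ λ s → sumℕ λ t → sumℕ λ y → h s t x y)
      ≡⟨ sum-cong-≗ {n} (λ x → sum-cong-≗ {n} λ s → ∑-comm {n} {n} _) ⟩
    sumℕ (λ x → sumℕ λ s → sumℕ λ y → sumℕ λ t → h s t x y)
      ≡⟨ sum-cong-≗ {n} (λ x → ∑-comm {n} {n} _) ⟩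
    sumℕ (λ x → sumℕ λ y → sumℕ λ s → sumℕ λ t → h s t x y) ∎
    where open ≡-Reasoning

  -- The point mass at the ordered pair (a, b). It counts single oriented edges within a double sum.
  at : Fin n → Fin n → Fin n → Fin n → ℕ
  at a b s t = [ s Fin.≟ a ] * [ t Fin.≟ b ]

  at-refl : ∀ a b → at a b a b ≡ 1
  at-refl a b = cong₂ _*_ ([]-yes (a Fin.≟ a) refl) ([]-yes (b Fin.≟ b) refl)

  at-≢ : ∀ {a b s t} → ¬ (s ≡ a × t ≡ b) → at a b s t ≡ 0
  at-≢ {a} {b} {s} {t} ≢ with s Fin.≟ a
  ... | no  _   = refl
  ... | yes s≡a = trans (*-identityˡ _) ([]-no (t Fin.≟ b) (λ t≡b → ≢ (s≡a , t≡b)))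

  ∑∑-at : ∀ a b → ∑∑ (at a b) ≡ 1
  ∑∑-at a b = trans (sym (sum-*-sum (λ s → [ s Fin.≟ a ]) (λ t → [ t Fin.≟ b ])))
                    (cong₂ _*_ (sum-indicator a) (sum-indicator b))

  at-≤ : ∀ (h : Fin n → Fin n → ℕ) a b → 1 ≤ h a b → ∀ s t → at a b s t ≤ h s t
  at-≤ h a b 1≤h s t with s Fin.≟ a | t Fin.≟ b
  ... | yes refl | yes refl = 1≤h
  ... | yes _    | no _     = z≤n
  ... | no _     | _        = z≤n

  -- Both indices run over pairs with s < t. This passes to ordered pairs, where summations can be
  -- exchanged freely.
  sum-half : (h : Fin n → Fin n → ℕ) → (∀ s t → h s t ≡ h t s) → (∀ s → h s s ≡ 0) →
             ∑∑ h ≡ 2 * ∑∑ (λ s t → if does (s Fin.<? t) then h s t else 0)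
  sum-half h h-sym h-diag = begin
    ∑∑ h                                          ≡⟨ ∑∑-cong split ⟩
    ∑∑ (λ s t → upper s t + upper t s)            ≡⟨ ∑∑-+ upper (λ s t → upper t s) ⟩
    ∑∑ upper + ∑∑ (λ s t → upper t s)             ≡⟨ cong (∑∑ upper +_) (∑-comm {n} {n} (λ s t → upper t s)) ⟩
    ∑∑ upper + ∑∑ upper                           ≡⟨ cong (∑∑ upper +_) (sym (+-identityʳ _)) ⟩
    2 * ∑∑ upper                                  ∎
    where
    open ≡-Reasoning
    upper : Fin n → Fin n → ℕ
    upper s t = if does (s Fin.<? t) then h s t else 0
    split : ∀ s t → h s t ≡ upper s t + upper t s
    split s t with Fin.<-cmp s t
    ... | tri< s<t _ t≮s rewrite dec-true (s Fin.<? t) s<t | dec-false (t Fin.<? s) t≮s = sym (+-identityʳ _)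
    ... | tri> s≮t _ t<s rewrite dec-false (s Fin.<? t) s≮t | dec-true (t Fin.<? s) t<s = h-sym s t
    ... | tri≈ s≮s refl _ rewrite dec-false (s Fin.<? s) s≮s = h-diag s

-- Rational arithmetic of the revised Szeged index

-- The gcd in `_/_` blocks computation for a variable k, so identities and inequalities are checked
-- on unnormalised fractions and carried back.
⟦⟧-unnormalised : ∀ k → ℚ.toℚᵘ ⟦ k ⟧ ℚᵘ.≃ ℚᵘ.mkℚᵘ (ℤ.+ k) 0
⟦⟧-unnormalised k = ℚ.toℚᵘ-fromℚᵘ (ℚᵘ.mkℚᵘ (ℤ.+ k) 0)

⟦⟧-+ : ∀ m n → ⟦ m + n ⟧ ≡ ⟦ m ⟧ ℚ.+ ⟦ n ⟧
⟦⟧-+ m n = ℚ.toℚᵘ-injective (begin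
  ℚ.toℚᵘ ⟦ m + n ⟧                                  ≈⟨ ⟦⟧-unnormalised (m + n) ⟩
  ℚᵘ.mkℚᵘ (ℤ.+ (m + n)) 0                           ≈⟨ ℚᵘ.*≡* (cong (ℤ._* ℤ.1ℤ) (sym (cong₂ ℤ._+_ (ℤ.*-identityʳ (ℤ.+ m)) (ℤ.*-identityʳ (ℤ.+ n))))) ⟩
  ℚᵘ.mkℚᵘ (ℤ.+ m) 0 ℚᵘ.+ ℚᵘ.mkℚᵘ (ℤ.+ n) 0          ≈⟨ ℚᵘ.+-cong (⟦⟧-unnormalised m) (⟦⟧-unnormalised n) ⟨
  ℚ.toℚᵘ ⟦ m ⟧ ℚᵘ.+ ℚ.toℚᵘ ⟦ n ⟧                    ≈⟨ ℚ.toℚᵘ-homo-+ ⟦ m ⟧ ⟦ n ⟧ ⟨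
  ℚ.toℚᵘ (⟦ m ⟧ ℚ.+ ⟦ n ⟧)                          ∎)
  where open ℚᵘ.≃-Reasoning

⟦⟧-* : ∀ m n → ⟦ m * n ⟧ ≡ ⟦ m ⟧ ℚ.* ⟦ n ⟧
⟦⟧-* m n = ℚ.toℚᵘ-injective (begin
  ℚ.toℚᵘ ⟦ m * n ⟧                                  ≈⟨ ⟦⟧-unnormalised (m * n) ⟩
  ℚᵘ.mkℚᵘ (ℤ.+ (m * n)) 0                           ≈⟨ ℚᵘ.*≡* (cong (ℤ._* ℤ.1ℤ) (ℤ.pos-* m n)) ⟩
  ℚᵘ.mkℚᵘ (ℤ.+ m) 0 ℚᵘ.* ℚᵘ.mkℚᵘ (ℤ.+ n) 0          ≈⟨ ℚᵘ.*-cong (⟦⟧-unnormalised m) (⟦⟧-unnormalised n) ⟨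
  ℚ.toℚᵘ ⟦ m ⟧ ℚᵘ.* ℚ.toℚᵘ ⟦ n ⟧                    ≈⟨ ℚ.toℚᵘ-homo-* ⟦ m ⟧ ⟦ n ⟧ ⟨
  ℚ.toℚᵘ (⟦ m ⟧ ℚ.* ⟦ n ⟧)                          ∎)
  where open ℚᵘ.≃-Reasoning

⟦⟧-mono-≤ : ∀ {m n} → m ≤ n → ⟦ m ⟧ ℚ.≤ ⟦ n ⟧
⟦⟧-mono-≤ {m} {n} m≤n = ℚ.toℚᵘ-cancel-≤
  (ℚᵘ.≤-respˡ-≃ (ℚᵘ.≃-sym (⟦⟧-unnormalised m)) (ℚᵘ.≤-respʳ-≃ (ℚᵘ.≃-sym (⟦⟧-unnormalised n))
    (ℚᵘ.*≤* (ℤ.*-monoʳ-≤-nonNeg ℤ.1ℤ (ℤ.+≤+ m≤n)))))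

⟦⟧-injective : ∀ {m n} → ⟦ m ⟧ ≡ ⟦ n ⟧ → m ≡ n
⟦⟧-injective {m} {n} eq
  with ℚᵘ.*≡* e ← ℚᵘ.≃-trans (ℚᵘ.≃-sym (⟦⟧-unnormalised m))
                    (ℚᵘ.≃-trans (ℚ.toℚᵘ-cong eq) (⟦⟧-unnormalised n))
  = ℤ.+-injective (ℤ.*-cancelʳ-≡ _ _ ℤ.1ℤ e)

-- Each share is half a natural number, so the revised Szeged index is `¼` times a natural number.
-- As 2 W is `¼` times 8 W, the comparison takes place in ℕ.
¼ : ℚ
¼ = ½ ℚ.* ½

¼-cancel : ∀ {m n} → ¼ ℚ.* ⟦ m ⟧ ≡ ¼ ℚ.* ⟦ n ⟧ → m ≡ n
¼-cancel {m} {n} eq = ⟦⟧-injective (begin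
  ⟦ m ⟧                        ≡⟨ ℚ.*-identityˡ ⟦ m ⟧ ⟨
  -- The closed product `⟦ 4 ⟧ ℚ.* ¼` evaluates to `1ℚ`.
  1ℚ ℚ.* ⟦ m ⟧                 ≡⟨ ℚ.*-assoc ⟦ 4 ⟧ ¼ ⟦ m ⟧ ⟩
  ⟦ 4 ⟧ ℚ.* (¼ ℚ.* ⟦ m ⟧)      ≡⟨ cong (⟦ 4 ⟧ ℚ.*_) eq ⟩
  ⟦ 4 ⟧ ℚ.* (¼ ℚ.* ⟦ n ⟧)      ≡⟨ ℚ.*-assoc ⟦ 4 ⟧ ¼ ⟦ n ⟧ ⟨
  1ℚ ℚ.* ⟦ n ⟧                 ≡⟨ ℚ.*-identityˡ ⟦ n ⟧ ⟩
  ⟦ n ⟧                        ∎)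
  where open ≡-Reasoning

¼-mono-≤ : ∀ {m n} → m ≤ n → ¼ ℚ.* ⟦ m ⟧ ℚ.≤ ¼ ℚ.* ⟦ n ⟧
¼-mono-≤ m≤n = ℚ.*-monoˡ-≤-nonNeg ¼ (⟦⟧-mono-≤ m≤n)

sumℚ-cong : ∀ {n} {f g : Fin n → ℚ} → (∀ i → f i ≡ g i) → sumℚ f ≡ sumℚ g
sumℚ-cong {zero}  f≡g = refl
sumℚ-cong {suc n} f≡g = cong₂ ℚ._+_ (f≡g zero) (sumℚ-cong (f≡g ∘ suc))

sumℚ-scaled : ∀ {n} c (f : Fin n → ℕ) → sumℚ (λ i → c ℚ.* ⟦ f i ⟧) ≡ c ℚ.* ⟦ sumℕ f ⟧
sumℚ-scaled {zero}  c f = sym (ℚ.*-zeroʳ c)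
sumℚ-scaled {suc n} c f = begin
  c ℚ.* ⟦ m ⟧ ℚ.+ sumℚ (λ i → c ℚ.* ⟦ f (suc i) ⟧) ≡⟨ cong (c ℚ.* ⟦ m ⟧ ℚ.+_) (sumℚ-scaled c (f ∘ suc)) ⟩
  c ℚ.* ⟦ m ⟧ ℚ.+ c ℚ.* ⟦ k ⟧                       ≡⟨ ℚ.*-distribˡ-+ c ⟦ m ⟧ ⟦ k ⟧ ⟨
  c ℚ.* (⟦ m ⟧ ℚ.+ ⟦ k ⟧)                           ≡⟨ cong (c ℚ.*_) (⟦⟧-+ m k) ⟨
  c ℚ.* ⟦ m + k ⟧                                   ∎
  where
  open ≡-Reasoning
  m k : ℕ
  m = f zero
  k = sumℕ (f ∘ suc)

half-of-sum : ∀ c e → ⟦ c ⟧ ℚ.+ ½ ℚ.* ⟦ e ⟧ ≡ ½ ℚ.* ⟦ 2 * c + e ⟧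
half-of-sum c e = sym (begin
  ½ ℚ.* ⟦ 2 * c + e ⟧                      ≡⟨ cong (½ ℚ.*_) (trans (⟦⟧-+ (2 * c) e) (cong (ℚ._+ ⟦ e ⟧) (⟦⟧-* 2 c))) ⟩
  ½ ℚ.* (⟦ 2 ⟧ ℚ.* ⟦ c ⟧ ℚ.+ ⟦ e ⟧)        ≡⟨ ℚ.*-distribˡ-+ ½ (⟦ 2 ⟧ ℚ.* ⟦ c ⟧) ⟦ e ⟧ ⟩
  ½ ℚ.* (⟦ 2 ⟧ ℚ.* ⟦ c ⟧) ℚ.+ ½ ℚ.* ⟦ e ⟧  ≡⟨ cong (ℚ._+ ½ ℚ.* ⟦ e ⟧) (ℚ.*-assoc ½ ⟦ 2 ⟧ ⟦ c ⟧) ⟨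
  1ℚ ℚ.* ⟦ c ⟧ ℚ.+ ½ ℚ.* ⟦ e ⟧             ≡⟨ cong (ℚ._+ ½ ℚ.* ⟦ e ⟧) (ℚ.*-identityˡ ⟦ c ⟧) ⟩
  ⟦ c ⟧ ℚ.+ ½ ℚ.* ⟦ e ⟧                    ∎)
  where open ≡-Reasoning

product-of-halves : ∀ a b → ½ ℚ.* ⟦ a ⟧ ℚ.* (½ ℚ.* ⟦ b ⟧) ≡ ¼ ℚ.* ⟦ a * b ⟧
product-of-halves a b = begin
  ½ ℚ.* p ℚ.* (½ ℚ.* q)    ≡⟨ ℚ.*-assoc ½ p (½ ℚ.* q) ⟩
  ½ ℚ.* (p ℚ.* (½ ℚ.* q))  ≡⟨ cong (½ ℚ.*_) (ℚ.*-assoc p ½ q) ⟨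
  ½ ℚ.* (p ℚ.* ½ ℚ.* q)    ≡⟨ cong (λ r → ½ ℚ.* (r ℚ.* q)) (ℚ.*-comm p ½) ⟩
  ½ ℚ.* (½ ℚ.* p ℚ.* q)    ≡⟨ cong (½ ℚ.*_) (ℚ.*-assoc ½ p q) ⟩
  ½ ℚ.* (½ ℚ.* (p ℚ.* q))  ≡⟨ ℚ.*-assoc ½ ½ (p ℚ.* q) ⟨
  ¼ ℚ.* (p ℚ.* q)          ≡⟨ cong (¼ ℚ.*_) (⟦⟧-* a b) ⟨
  ¼ ℚ.* ⟦ a * b ⟧          ∎
  where
  open ≡-Reasoning
  p q : ℚ
  p = ⟦ a ⟧
  q = ⟦ b ⟧

quarter-of-octuple : ∀ k → ⟦ 2 ⟧ ℚ.* ⟦ k ⟧ ≡ ¼ ℚ.* ⟦ 8 * k ⟧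
quarter-of-octuple k = trans (ℚ.*-assoc ¼ ⟦ 8 ⟧ ⟦ k ⟧) (cong (¼ ℚ.*_) (sym (⟦⟧-* 8 k)))

module _ {n : ℕ} (G : Graph n) where
  open Graph G

  doubleShare : Fin n → Fin n → ℕ
  doubleShare s t = 2 * closer G s t + equidistant G s t

  shares-quarter : ∀ s t → share G s t ℚ.* share G t s ≡ ¼ ℚ.* ⟦ doubleShare s t * doubleShare t s ⟧
  shares-quarter s t = trans
    (cong₂ ℚ._*_ (half-of-sum (closer G s t) (equidistant G s t))
                 (half-of-sum (closer G t s) (equidistant G t s)))
    (product-of-halves (doubleShare s t) (doubleShare t s))

  szegedSummand : Fin n → Fin n → ℕ
  szegedSummand s t =
    if does (s Fin.<? t ×-dec s ~? t) then doubleShare s t * doubleShare t s else 0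

  RevisedSzeged-quarter : RevisedSzeged G ≡ ¼ ℚ.* ⟦ ∑∑ szegedSummand ⟧
  RevisedSzeged-quarter = begin
    RevisedSzeged G
      ≡⟨ sumℚ-cong (λ s → sumℚ-cong λ t → summand (does (s Fin.<? t ×-dec s ~? t)) s t) ⟩
    sumℚ (λ s → sumℚ λ t → ¼ ℚ.* ⟦ szegedSummand s t ⟧)
      ≡⟨ sumℚ-cong (λ s → sumℚ-scaled ¼ (szegedSummand s)) ⟩
    sumℚ (λ s → ¼ ℚ.* ⟦ sumℕ (szegedSummand s) ⟧)
      ≡⟨ sumℚ-scaled ¼ (λ s → sumℕ (szegedSummand s)) ⟩
    ¼ ℚ.* ⟦ ∑∑ szegedSummand ⟧ ∎
    where
    open ≡-Reasoning
    summand : ∀ b s t → (if b then share G s t ℚ.* share G t s else 0ℚ) ≡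
              ¼ ℚ.* ⟦ if b then doubleShare s t * doubleShare t s else 0 ⟧
    summand true  s t = shares-quarter s t
    summand false s t = sym (ℚ.*-zeroʳ ¼)

-- Walks, distances and geodesics

module _ {A : Set} {R : Rel A 0ℓ} where

  infixr 5 _++ʷ_
  _++ʷ_ : ∀ {j k u v w} → Walk R j u v → Walk R k v w → Walk R (j + k) u w
  []      ++ʷ q = q
  (r ∷ p) ++ʷ q = r ∷ (p ++ʷ q)

  snoc : ∀ {k u v w} → Walk R k u v → R v w → Walk R (suc k) u w
  snoc []      s = s ∷ []
  snoc (r ∷ p) s = r ∷ snoc p s

  reverseʷ : Symmetric R → ∀ {k u v} → Walk R k u v → Walk R k v u
  reverseʷ R-sym []      = []
  reverseʷ R-sym (r ∷ p) = snoc (reverseʷ R-sym p) (R-sym r)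

  secondVertex : ∀ {k u v} → Walk R k u v → A
  -- A trivial walk has no second vertex; its only vertex serves as a default, which `next-spec`
  -- excludes by a positive distance.
  secondVertex {u = u} []              = u
  secondVertex (_∷_ {v = v} _ _) = v

  joined-refl : ∀ {u} → Joined R u u
  joined-refl = 0 , []

  joined-edge : ∀ {u v} → R u v → Joined R u v
  joined-edge r = 1 , r ∷ []

  joined-trans : ∀ {u v w} → Joined R u v → Joined R v w → Joined R u w
  joined-trans (_ , p) (_ , q) = _ , p ++ʷ q

  joined-sym : Symmetric R → ∀ {u v} → Joined R u v → Joined R v u
  joined-sym R-sym (_ , p) = _ , reverseʷ R-sym p

mapʷ : ∀ {A} {R S : Rel A 0ℓ} → (∀ {u v} → R u v → S u v) → ∀ {k u v} → Walk R k u v → Walk S k u v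
mapʷ f []      = []
mapʷ f (r ∷ p) = f r ∷ mapʷ f p

module Metric {n : ℕ} (G : Graph n) (connected : Connected G) where
  open Graph G

  d : Fin n → Fin n → ℕ
  d = dist G

  shortestWalk : ∀ u v → Walk _~_ (d u v) u v
  shortestWalk u v = proj₁ (dist-path G connected u v)

  d-refl : ∀ u → d u u ≡ 0
  d-refl u = n≤0⇒n≡0 (dist-shortest G {u = u} [])

  d-sym-≤ : ∀ u v → d v u ≤ d u v
  d-sym-≤ u v = dist-shortest G (reverseʷ ~-sym (shortestWalk u v))

  d-sym : ∀ u v → d u v ≡ d v u
  d-sym u v = ≤-antisym (d-sym-≤ v u) (d-sym-≤ u v)

  d-triangle : ∀ u v w → d u w ≤ d u v + d v w
  d-triangle u v w = dist-shortest G (shortestWalk u v ++ʷ shortestWalk v w)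

  d≡0⇒≡ : ∀ {u v} → d u v ≡ 0 → u ≡ v
  d≡0⇒≡ {u} {v} eq with [] ← subst (λ k → Walk _~_ k u v) eq (shortestWalk u v) = refl

  d-step : ∀ x {s t} → s ~ t → d x t ≤ suc (d x s)
  d-step x s~t = dist-shortest G (snoc (shortestWalk x _) s~t)

  next : Fin n → Fin n → Fin n
  next x w = secondVertex (shortestWalk w x)

  next-spec : ∀ x w → 0 < d x w → w ~ next x w × suc (d x (next x w)) ≡ d x w
  next-spec x w 0<d = go (shortestWalk w x) (d-sym w x)
    where
    go : ∀ {m} (p : Walk _~_ m w x) → m ≡ d x w → w ~ secondVertex p × suc (d x (secondVertex p)) ≡ d x w
    go [] eq = contradiction 0<d (<-irrefl eq)
    go (_∷_ {v = v} w~v p) eq = w~v , ≤-antisym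
      (≤-trans (s≤s (≤-trans (d-sym-≤ v x) (dist-shortest G p))) (≤-reflexive eq))
      (d-step x (~-sym w~v))

  -- A fixed descent from s to x, given as a sequence on ℕ so that arms of cycles can be indexed by
  -- it. Only terms up to `d x s` are used.
  geodesic : Fin n → Fin n → ℕ → Fin n
  geodesic x s zero    = s
  geodesic x s (suc i) = next x (geodesic x s i)

  module _ (x s : Fin n) where

    -- Each step lowers the distance to x by one. The recursion is mutual: a step may be taken only
    -- while the distance is positive, and that is known from the steps already taken.
    geodesic-d : ∀ i → i ≤ d x s → d x (geodesic x s i) + i ≡ d x s
    geodesic-spec : ∀ i → i < d x s →
      geodesic x s i ~ geodesic x s (suc i) × suc (d x (geodesic x s (suc i))) ≡ d x (geodesic x s i)
    geodesic-d zero    _   = +-identityʳ _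
    geodesic-d (suc i) i<d = trans (+-suc (d x (geodesic x s (suc i))) i)
      (trans (cong (_+ i) (proj₂ (geodesic-spec i i<d))) (geodesic-d i (<⇒≤ i<d)))
    geodesic-spec i i<d = next-spec x (geodesic x s i)
      (+-cancelʳ-< i 0 _ (subst (i <_) (sym (geodesic-d i (<⇒≤ i<d))) i<d))

    geodesic-~ : ∀ i → i < d x s → geodesic x s i ~ geodesic x s (suc i)
    geodesic-~ i i<d = proj₁ (geodesic-spec i i<d)

    geodesic-end : geodesic x s (d x s) ≡ x
    geodesic-end = sym (d≡0⇒≡ (m+n≡n⇒m≡0 (geodesic-d (d x s) ≤-refl)))
      where
      m+n≡n⇒m≡0 : ∀ {m n} → m + n ≡ n → m ≡ 0
      m+n≡n⇒m≡0 {m} {n} e = +-cancelʳ-≡ n m 0 e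

    -- The distance to x determines the position on the descent.
    geodesic-injective : ∀ {i j} → i ≤ d x s → j ≤ d x s → geodesic x s i ≡ geodesic x s j → i ≡ j
    geodesic-injective {i} {j} i≤ j≤ eq = +-cancelˡ-≡ (d x (geodesic x s i)) i j
      (trans (geodesic-d i i≤) (trans (sym (geodesic-d j j≤)) (cong (λ w → d x w + j) (sym eq))))

    d-along-geodesic : ∀ i → i ≤ d x s → d s (geodesic x s i) ≤ i
    d-along-geodesic zero    _   = ≤-reflexive (d-refl s)
    d-along-geodesic (suc i) i<d =
      ≤-trans (d-step s (geodesic-~ i i<d)) (s≤s (d-along-geodesic i (<⇒≤ i<d)))

  -- For an edge st this is 1 + f(x), no truncation taking place.
  tilt : Fin n → Fin n → Fin n → ℕ
  tilt x s t = suc (d x t) ∸ d x s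

  tilt-sum : ∀ x {s t} → s ~ t → tilt x s t + d x s ≡ suc (d x t)
  tilt-sum x s~t = m∸n+n≡m (d-step x (~-sym s~t))

  tilt-≤2 : ∀ x {s t} → s ~ t → tilt x s t ≤ 2
  tilt-≤2 x {s} s~t = m≤n+o⇒m∸n≤o (suc (d x _)) (d x s) (≤-trans (s≤s (d-step x s~t)) (≤-reflexive (+-comm 2 (d x s))))

  -- The three possible values 2, 1 and 0 of the tilt occur when x is nearer to s, equidistant, or
  -- nearer to t.
  tilt-indicators : ∀ x {s t} → s ~ t → 2 * [ d x s <? d x t ] + [ d x s ≟ d x t ] ≡ tilt x s t
  tilt-indicators x {s} {t} s~t with <-cmp (d x s) (d x t)
  ... | tri< s<t s≢t _
    rewrite []-yes (d x s <? d x t) s<t | []-no (d x s ≟ d x t) s≢t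
          | ≤-antisym (d-step x s~t) s<t
          = sym (m+n∸n≡m 2 (d x s))
  ... | tri≈ s≮t s≡t _
    rewrite []-no (d x s <? d x t) s≮t | []-yes (d x s ≟ d x t) s≡t | s≡t
          = sym (m+n∸n≡m 1 (d x t))
  ... | tri> s≮t s≢t t<s
    rewrite []-no (d x s <? d x t) s≮t | []-no (d x s ≟ d x t) s≢t
          = sym (m≤n⇒m∸n≡0 t<s)

  doubleShare-tilt : ∀ {s t} → s ~ t → doubleShare G s t ≡ sumℕ (λ x → tilt x s t)
  doubleShare-tilt {s} {t} s~t = begin
    doubleShare G s t
      ≡⟨ cong₂ (λ c e → 2 * c + e) (length-filter (λ w → d w s <? d w t) id) (length-filter (λ w → d w s ≟ d w t) id) ⟩
    2 * sumℕ (λ x → [ d x s <? d x t ]) + sumℕ (λ x → [ d x s ≟ d x t ])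
      ≡⟨ cong (_+ sumℕ (λ x → [ d x s ≟ d x t ])) (*-distribˡ-sum {n} 2 (λ x → [ d x s <? d x t ])) ⟩
    sumℕ (λ x → 2 * [ d x s <? d x t ]) + sumℕ (λ x → [ d x s ≟ d x t ])
      ≡⟨ ∑-distrib-+ {n} (λ x → 2 * [ d x s <? d x t ]) (λ x → [ d x s ≟ d x t ]) ⟨
    sumℕ (λ x → 2 * [ d x s <? d x t ] + [ d x s ≟ d x t ])
      ≡⟨ sum-cong-≗ {n} (λ x → tilt-indicators x s~t) ⟩
    sumℕ (λ x → tilt x s t) ∎
    where open ≡-Reasoning

  -- The function F(x, y) of the opening comment: `tilt y t s` is 1 - f(y), and every edge enters
  -- with both orientations.
  contribution : Fin n → Fin n → ℕ
  contribution x y = ∑∑ λ s t → [ s ~? t ] * (tilt x s t * tilt y t s)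

  double-Wiener : 2 * Wiener G ≡ ∑∑ d
  double-Wiener = sym (sum-half d d-sym d-refl)

  -- Ordered pairs count every edge twice. The product of the two doubled shares is expanded over x
  -- and y, and the order of summation is exchanged.
  double-szeged : 2 * ∑∑ (szegedSummand G) ≡ ∑∑ contribution
  double-szeged = begin
    2 * ∑∑ (szegedSummand G)
      ≡⟨ cong (2 *_) (∑∑-cong λ s t → as-product (does (s Fin.<? t)) (does (s ~? t)) _) ⟩
    2 * ∑∑ (λ s t → if does (s Fin.<? t) then h s t else 0)
      ≡⟨ sum-half h h-sym h-diag ⟨
    ∑∑ h
      ≡⟨ ∑∑-cong expand ⟩
    ∑∑ (λ s t → ∑∑ (λ x y → [ s ~? t ] * (tilt x s t * tilt y t s)))
      ≡⟨ ∑∑-swap (λ s t x y → [ s ~? t ] * (tilt x s t * tilt y t s)) ⟩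
    ∑∑ contribution ∎
    where
    open ≡-Reasoning
    h : Fin n → Fin n → ℕ
    h s t = [ s ~? t ] * (doubleShare G s t * doubleShare G t s)
    as-product : ∀ a b m → (if a ∧ b then m else 0) ≡ (if a then (if b then 1 else 0) * m else 0)
    as-product true  true  m = sym (*-identityˡ m)
    as-product true  false m = refl
    as-product false _     m = refl
    h-diag : ∀ s → h s s ≡ 0
    h-diag s rewrite []-no (s ~? s) (~-irrefl refl) = refl
    h-sym : ∀ s t → h s t ≡ h t s
    h-sym s t with s ~? t | t ~? s
    ... | yes _   | yes _   = cong (1 *_) (*-comm (doubleShare G s t) (doubleShare G t s))
    ... | yes s~t | no t≁s  = contradiction (~-sym s~t) t≁s
    ... | no s≁t  | yes t~s = contradiction (~-sym t~s) s≁t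
    ... | no _    | no _    = refl
    expand : ∀ s t → h s t ≡ ∑∑ (λ x y → [ s ~? t ] * (tilt x s t * tilt y t s))
    expand s t with s ~? t
    ... | no _    = sym (trans (∑∑-* 0 (λ x y → tilt x s t * tilt y t s)) refl)
    ... | yes s~t = begin
      1 * (doubleShare G s t * doubleShare G t s)
        ≡⟨ cong (1 *_) (cong₂ _*_ (doubleShare-tilt s~t) (doubleShare-tilt (~-sym s~t))) ⟩
      1 * (sumℕ (λ x → tilt x s t) * sumℕ (λ y → tilt y t s))
        ≡⟨ cong (1 *_) (sum-*-sum (λ x → tilt x s t) (λ y → tilt y t s)) ⟩
      1 * ∑∑ (λ x y → tilt x s t * tilt y t s)
        ≡⟨ ∑∑-* 1 (λ x y → tilt x s t * tilt y t s) ⟨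
      ∑∑ (λ x y → 1 * (tilt x s t * tilt y t s)) ∎

-- The lower bound for bridgeless graphs

-- The two point masses have disjoint supports, so their sum stays below h.
∑∑-two : ∀ {n} (h : Fin n → Fin n → ℕ) {a b a′ b′} → 1 ≤ h a b → 1 ≤ h a′ b′ →
         ¬ (a′ ≡ a × b′ ≡ b) → 2 ≤ ∑∑ h
∑∑-two h {a} {b} {a′} {b′} 1≤h 1≤h′ distinct = begin
  2                                      ≡⟨ cong₂ _+_ (∑∑-at a b) (∑∑-at a′ b′) ⟨
  ∑∑ (at a b) + ∑∑ (at a′ b′)            ≡⟨ ∑∑-+ (at a b) (at a′ b′) ⟨
  ∑∑ (λ s t → at a b s t + at a′ b′ s t) ≤⟨ ∑∑-mono-≤ both ⟩
  ∑∑ h                                   ∎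
  where
  open ≤-Reasoning
  both : ∀ s t → at a b s t + at a′ b′ s t ≤ h s t
  both s t with (s Fin.≟ a′) ×-dec (t Fin.≟ b′)
  ... | yes (refl , refl) rewrite at-≢ distinct = at-≤ h a′ b′ 1≤h′ s t
  ... | no ≢ rewrite at-≢ ≢ | +-identityʳ (at a b s t) = at-≤ h a b 1≤h s t

crossing : ∀ {A : Set} {R : Rel A 0ℓ} {P : A → Set} → Unary.Decidable P → ∀ {k x y} →
           Walk R k x y → P x → ¬ P y → ∃[ s ] ∃[ t ] R s t × P s × ¬ P t
crossing P? []                Px ¬Py = contradiction Px ¬Py
crossing P? (_∷_ {v = v} r p) Px ¬Py with P? v
... | yes Pv = crossing P? p Pv ¬Py
... | no ¬Pv = _ , _ , r , Px , ¬Pv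

-- Over the integers, ij - 2 (i + j - 2) = (2 - i)(2 - j), which is nonnegative here. Truncated
-- subtraction supplies the maximum with 0.
product≥sum-2 : ∀ i j → i ≤ 2 → j ≤ 2 → 2 * (i + j ∸ 2) ≤ i * j
product≥sum-2 0 0 _ _ = z≤n
product≥sum-2 0 1 _ _ = z≤n
product≥sum-2 0 2 _ _ = z≤n
product≥sum-2 1 0 _ _ = z≤n
product≥sum-2 1 1 _ _ = z≤n
product≥sum-2 1 2 _ _ = ≤-refl
product≥sum-2 2 0 _ _ = z≤n
product≥sum-2 2 1 _ _ = ≤-refl
product≥sum-2 2 2 _ _ = ≤-refl
product≥sum-2 (suc (suc (suc _))) _ (s≤s (s≤s ())) _
product≥sum-2 0 (suc (suc (suc _))) _ (s≤s (s≤s ()))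
product≥sum-2 1 (suc (suc (suc _))) _ (s≤s (s≤s ()))
product≥sum-2 2 (suc (suc (suc _))) _ (s≤s (s≤s ()))

module _ {n : ℕ} {G : Graph n} (cycleBlocks : ∀ (B : Subgraph G) → Block B → Cycle B) where
  open Graph G

  -- A bridge would be a block with only two vertices, whereas a cycle has three distinct ones.
  bridgeless : ∀ {s t} → ¬ Bridge {G = G} s t
  bridgeless {s} {t} bridge = absurd (cycleBlocks B (inj₂ (s , t , bridge , refl , inj₁ (refl , refl))))
    where
    B : Subgraph G
    B = record
      { V      = ⁅ s ⁆ ∪ ⁅ t ⁆
      ; E      = λ u v → (u ≡ s × v ≡ t) ⊎ (u ≡ t × v ≡ s)
      ; E?     = λ u v → (u Fin.≟ s ×-dec v Fin.≟ t) ⊎-dec (u Fin.≟ t ×-dec v Fin.≟ s)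
      ; E-sym  = λ { (inj₁ (p , q)) → inj₂ (q , p) ; (inj₂ (p , q)) → inj₁ (q , p) }
      ; E⇒~    = λ { (inj₁ (refl , refl)) → proj₁ bridge ; (inj₂ (refl , refl)) → ~-sym (proj₁ bridge) }
      ; E-in-V = λ { (inj₁ (refl , _)) → x∈p∪q⁺ (inj₁ (x∈⁅x⁆ s)) ; (inj₂ (refl , _)) → x∈p∪q⁺ (inj₂ (x∈⁅x⁆ t)) }
      }
    absurd : ¬ Cycle B
    absurd (suc (suc (suc k)) , _ , c , c-inj , V⇔ , _) =
      clash (end zero) (end (suc zero)) (end (suc (suc zero)))
      where
      end : ∀ i → c i ≡ s ⊎ c i ≡ t
      end i = Sum.map (x∈⁅y⁆⇒x≡y s) (x∈⁅y⁆⇒x≡y t)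
        (x∈p∪q⁻ ⁅ s ⁆ ⁅ t ⁆ (Equivalence.from (V⇔ (c i)) (i , refl)))
      same : ∀ {i j v} → i ≢ j → c i ≡ v → c j ≡ v → ⊥
      same i≢j p q = i≢j (c-inj (trans p (sym q)))
      clash : _ → _ → _ → ⊥
      clash (inj₁ p) (inj₁ q) _        = same (λ ()) p q
      clash (inj₂ p) (inj₂ q) _        = same (λ ()) p q
      clash (inj₁ p) _        (inj₁ r) = same (λ ()) p r
      clash (inj₂ p) _        (inj₂ r) = same (λ ()) p r
      clash _        (inj₁ q) (inj₁ r) = same (λ ()) q r
      clash _        (inj₂ q) (inj₂ r) = same (λ ()) q r
    absurd (1 , s≤s () , _)
    absurd (2 , s≤s (s≤s ()) , _)

  -- Some walk from s to t avoids the edge st, and it too must leave P. That such a walk exists is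
  -- known only up to double negation, which a decidable search over all edges removes.
  second-crossing : ∀ {P : Fin n → Set} → Unary.Decidable P → ∀ {s t} → s ~ t → P s → ¬ P t →
    ∃[ s′ ] ∃[ t′ ] (s′ ~ t′ × P s′ × ¬ P t′) × ¬ (s′ ≡ s × t′ ≡ t)
  second-crossing P? {s} {t} s~t Ps ¬Pt = decidable-stable
    (Fin.any? λ s′ → Fin.any? λ t′ →
      (s′ ~? t′ ×-dec P? s′ ×-dec ¬? (P? t′)) ×-dec ¬? (s′ Fin.≟ s ×-dec t′ Fin.≟ t))
    λ none → bridgeless (s~t , λ (_ , p) →
      let s′ , t′ , (s′~t′ , ≢) , Ps′ , ¬Pt′ = crossing P? p Ps ¬Pt
      in none (s′ , t′ , (s′~t′ , Ps′ , ¬Pt′) , ≢ ∘ inj₁))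

  module _ (connected : Connected G) where
    open Metric G connected

    -- Each level cut {U ≤ c} with U x ≤ c < U y is crossed by at least two
    -- edges, as no edge is a bridge; pred peels off the lowest level.
    potential-rise : ∀ m (U : Fin n → ℕ) {x y} → U x ≡ 0 → U y ≡ m →
                     2 * m ≤ ∑∑ (λ s t → [ s ~? t ] * (U t ∸ U s))
    potential-rise zero    U Ux Uy = z≤n
    potential-rise (suc m) U {x} {y} Ux Uy = begin
      2 * suc m
        ≡⟨ *-suc 2 m ⟩
      2 + 2 * m
        ≤⟨ +-mono-≤ two (potential-rise m (pred ∘ U) (cong pred Ux) (cong pred Uy)) ⟩
      ∑∑ cut + ∑∑ (λ s t → [ s ~? t ] * (pred (U t) ∸ pred (U s)))
        ≡⟨ ∑∑-+ cut _ ⟨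
      ∑∑ (λ s t → cut s t + [ s ~? t ] * (pred (U t) ∸ pred (U s)))
        ≤⟨ ∑∑-mono-≤ peel ⟩
      ∑∑ (λ s t → [ s ~? t ] * (U t ∸ U s)) ∎
      where
      open ≤-Reasoning
      Z? : ∀ w → Dec (U w ≡ 0)
      Z? w = U w ≟ 0
      cut : Fin n → Fin n → ℕ
      cut s t = [ s ~? t ×-dec Z? s ×-dec ¬? (Z? t) ]
      cut-≥1 : ∀ {s t} → s ~ t × U s ≡ 0 × U t ≢ 0 → 1 ≤ cut s t
      cut-≥1 {s} {t} c = ≤-reflexive (sym ([]-yes (s ~? t ×-dec Z? s ×-dec ¬? (Z? t)) c))
      two : 2 ≤ ∑∑ cut
      two with s , t , e@(s~t , s0 , t0) ← crossing Z? (shortestWalk x y) Ux (λ y0 → 1+n≢0 (trans (sym Uy) y0))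
          with s′ , t′ , e′ , ≢ ← second-crossing Z? s~t s0 t0
          = ∑∑-two cut (cut-≥1 e) (cut-≥1 e′) ≢
      peel : ∀ s t → cut s t + [ s ~? t ] * (pred (U t) ∸ pred (U s)) ≤ [ s ~? t ] * (U t ∸ U s)
      peel s t with s ~? t | U s | U t
      ... | no _  | _     | _     = z≤n
      ... | yes _ | zero  | zero  = z≤n
      ... | yes _ | zero  | suc _ = ≤-refl
      ... | yes _ | suc a | zero  rewrite 0∸n≡0 a = z≤n
      ... | yes _ | suc a | suc b = ≤-refl

    -- The factor 8 is 2 · 2 · 2: the potential rises by 2 d(x, y), each unit level is crossed by
    -- two edges, and each product is at least twice the increment.
    contribution-≥ : ∀ x y → 8 * d x y ≤ contribution x y
    contribution-≥ x y = begin
      8 * D                                           ≡⟨ *-assoc 4 2 D ⟩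
      4 * (2 * D)                                     ≡⟨ *-assoc 2 2 (2 * D) ⟩
      2 * (2 * (2 * D))                               ≤⟨ *-monoʳ-≤ 2 (potential-rise (2 * D) U Ux Uy) ⟩
      2 * ∑∑ (λ s t → [ s ~? t ] * (U t ∸ U s))       ≡⟨ ∑∑-* 2 (λ s t → [ s ~? t ] * (U t ∸ U s)) ⟨
      ∑∑ (λ s t → 2 * ([ s ~? t ] * (U t ∸ U s)))     ≤⟨ ∑∑-mono-≤ edge ⟩
      contribution x y                                ∎
      where
      open ≤-Reasoning
      D : ℕ
      D = d x y
      U : Fin n → ℕ
      -- The shift by `D` keeps the potential d(x,·) - d(y,·) within ℕ; its least value -d(x, y) is
      -- attained at x.
      U w = (d x w + D) ∸ d y w
      Ux : U x ≡ 0
      Ux = trans (cong₂ (λ a b → (a + D) ∸ b) (d-refl x) (d-sym y x)) (n∸n≡0 D)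
      Uy : U y ≡ 2 * D
      Uy = trans (cong ((D + D) ∸_) (d-refl y)) (cong (D +_) (sym (+-identityʳ D)))
      U-sum : ∀ w → U w + d y w ≡ d x w + D
      U-sum w = m∸n+n≡m (≤-trans (d-triangle y x w)
        (≤-reflexive (trans (cong (_+ d x w) (d-sym y x)) (+-comm D (d x w)))))
      -- This is f(x) - f(y) = (1 + f(x)) + (1 - f(y)) - 2, written without subtraction.
      rise : ∀ {s t} → s ~ t → U t + 2 ≡ U s + (tilt x s t + tilt y t s)
      rise {s} {t} s~t = +-cancelʳ-≡ (d x s + d y t + D) _ _ (eqn (U s) (U t) (tilt x s t) (tilt y t s)
        (d x s) (d x t) (d y s) (d y t) D (U-sum s) (U-sum t) (tilt-sum x s~t) (tilt-sum y (~-sym s~t)))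
        where
        eqn : ∀ r r′ i j a a′ b b′ D → r + b ≡ a + D → r′ + b′ ≡ a′ + D → i + a ≡ suc a′ → j + b′ ≡ suc b →
              r′ + 2 + (a + b′ + D) ≡ r + (i + j) + (a + b′ + D)
        eqn r r′ i j a a′ b b′ D e e′ f f′ = begin-equality
          r′ + 2 + (a + b′ + D)           ≡⟨ solve 4 (λ r′ a b′ D → r′ :+ con 2 :+ (a :+ b′ :+ D) := (r′ :+ b′) :+ (con 2 :+ (a :+ D))) refl r′ a b′ D ⟩
          r′ + b′ + (2 + (a + D))         ≡⟨ cong₂ (λ p q → p + (2 + q)) e′ (sym e) ⟩
          a′ + D + (2 + (r + b))          ≡⟨ solve 4 (λ a′ D r b → a′ :+ D :+ (con 2 :+ (r :+ b)) := r :+ (con 1 :+ a′ :+ (con 1 :+ b)) :+ D) refl a′ D r b ⟩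
          r + (suc a′ + suc b) + D        ≡⟨ cong₂ (λ p q → r + (p + q) + D) (sym f) (sym f′) ⟩
          r + (i + a + (j + b′)) + D      ≡⟨ solve 6 (λ r i a j b′ D → r :+ (i :+ a :+ (j :+ b′)) :+ D := r :+ (i :+ j) :+ (a :+ b′ :+ D)) refl r i a j b′ D ⟩
          r + (i + j) + (a + b′ + D)      ∎
          where open +-*-Solver
      edge : ∀ s t → 2 * ([ s ~? t ] * (U t ∸ U s)) ≤ [ s ~? t ] * (tilt x s t * tilt y t s)
      edge s t with s ~? t
      ... | no _    = z≤n
      ... | yes s~t = begin
        2 * (1 * (U t ∸ U s))            ≡⟨ cong (2 *_) (*-identityˡ (U t ∸ U s)) ⟩
        2 * (U t ∸ U s)                  ≡⟨ cong (2 *_) ([m+n]∸[m+o]≡n∸o 2 (U t) (U s)) ⟨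
        2 * (2 + U t ∸ (2 + U s))        ≡⟨ cong₂ (λ p q → 2 * (p ∸ q)) (trans (+-comm 2 (U t)) (rise s~t)) (+-comm 2 (U s)) ⟩
        2 * (U s + (i + j) ∸ (U s + 2))  ≡⟨ cong (2 *_) ([m+n]∸[m+o]≡n∸o (U s) (i + j) 2) ⟩
        2 * (i + j ∸ 2)                  ≤⟨ product≥sum-2 i j (tilt-≤2 x s~t) (tilt-≤2 y (~-sym s~t)) ⟩
        i * j                            ≡⟨ *-identityˡ (i * j) ⟨
        1 * (i * j)                      ∎
        where
        i j : ℕ
        i = tilt x s t
        j = tilt y t s

-- Equality on the diagonal and the parity of distances

module _ {n : ℕ} (G : Graph n) (connected : Connected G) where
  open Graph G
  open Metric G connected

  -- No f has a zero. For a connected graph this is bipartiteness in metric form.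
  EdgesTilted : Set
  EdgesTilted = ∀ x {s t} → s ~ t → d x s ≢ d x t

  -- For y = x the summand of an edge is 1 - f(x)², so a zero of f would contribute 1.
  contribution-diagonal-0⇒tilted : (∀ x → contribution x x ≡ 0) → EdgesTilted
  contribution-diagonal-0⇒tilted zero-diag x {s} {t} s~t eq = 1+n≰n (begin
    1                 ≡⟨ ∑∑-at s t ⟨
    ∑∑ (at s t)       ≤⟨ ∑∑-mono-≤ (at-≤ _ s t (≤-reflexive (sym one))) ⟩
    contribution x x  ≡⟨ zero-diag x ⟩
    0                 ∎)
    where
    open ≤-Reasoning
    one : [ s ~? t ] * (tilt x s t * tilt x t s) ≡ 1
    one rewrite []-yes (s ~? t) s~t | eq | m+n∸n≡m 1 (d x t) = refl

  tilted⇒contribution-diagonal-0 : EdgesTilted → ∀ x → contribution x x ≡ 0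
  tilted⇒contribution-diagonal-0 tilted x =
    trans (∑∑-cong {g = λ _ _ → 0 * 0} term) (∑∑-* {n} 0 (λ _ _ → 0))
    where
    term : ∀ s t → [ s ~? t ] * (tilt x s t * tilt x t s) ≡ 0
    term s t with s ~? t
    ... | no _    = refl
    ... | yes s~t with <-cmp (d x s) (d x t)
    ...   | tri< s<t _ _ rewrite m≤n⇒m∸n≡0 s<t | *-zeroʳ (tilt x s t) = refl
    ...   | tri≈ _ s≡t _ = contradiction s≡t (tilted x s~t)
    ...   | tri> _ _ t<s rewrite m≤n⇒m∸n≡0 t<s = refl

  -- Starting at x = c 0, the parity of d(x, c m) + m is constant, since the distance changes by
  -- exactly one at each step. The last vertex, of index k in a cycle of length k + 1, is at
  -- distance 1 from x, so 1 + k is even.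
  tilted⇒even-cycles : EdgesTilted → ∀ (C : Subgraph G) k → CycleOfLength k C → 2 ∣ k
  tilted⇒even-cycles tilted C (suc k) (3≤k , c , _ , _ , E⇔) =
    subst (λ m → 2 ∣ m + k) last-d (parity k ≤-refl)
    where
    x : Fin n
    x = c zero
    cyclic-~ : ∀ {i j} → CyclicSuc i j → c i ~ c j
    cyclic-~ s = Subgraph.E⇒~ C (Equivalence.from (E⇔ _ _) (inj₁ s))
    step : ∀ m {s t} → s ~ t → 2 ∣ d x s + m → 2 ∣ d x t + suc m
    step m {s} {t} s~t even with <-cmp (d x s) (d x t)
    ... | tri< s<t _ _ = subst (2 ∣_)
      (trans (cong suc (sym (+-suc (d x s) m))) (cong (_+ suc m) (≤-antisym s<t (d-step x s~t))))
      (∣m∣n⇒∣m+n ∣-refl even)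
    ... | tri≈ _ s≡t _ = contradiction s≡t (tilted x s~t)
    ... | tri> _ _ t<s = subst (2 ∣_)
      (trans (cong (_+ m) (≤-antisym (d-step x (~-sym s~t)) t<s)) (sym (+-suc (d x t) m))) even
    parity : ∀ m (m<k : m < suc k) → 2 ∣ d x (c (fromℕ< m<k)) + m
    parity zero    (s≤s _)   = subst (λ a → 2 ∣ a + 0) (sym (d-refl x)) (divides 0 refl)
    parity (suc m) m<k =
      step m (cyclic-~ (inj₁ (trans (Fin.toℕ-fromℕ< m<k) (cong suc (sym (Fin.toℕ-fromℕ< (<⇒≤ m<k)))))))
        (parity m (<⇒≤ m<k))
    last~x : c (fromℕ< {k} ≤-refl) ~ x
    last~x = cyclic-~ (inj₂ (refl , cong suc (Fin.toℕ-fromℕ< ≤-refl)))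
    last-d : d x (c (fromℕ< {k} ≤-refl)) ≡ 1
    last-d = ≤-antisym
      (≤-trans (d-step x (~-sym last~x)) (s≤s (≤-reflexive (d-refl x))))
      (n≢0⇒n>0 (λ 0≡ → tilted x last~x (trans 0≡ (sym (d-refl x)))))

-- Subsets of the vertex set

module _ {n : ℕ} where

  -- Deleting x from p - x changes nothing, whereas deleting a member lowers the cardinality.
  x∉p-x : ∀ (p : Subset n) x → x ∉ p - x
  x∉p-x p x x∈ = <-irrefl (cong ∣_∣ (p─q─q≡p─q p ⁅ x ⁆)) (x∈p⇒∣p-x∣<∣p∣ x∈)

  x∈p-y⇒x≢y : ∀ {p : Subset n} {x y} → x ∈ p - y → x ≢ y
  x∈p-y⇒x≢y {p} {x} x∈ refl = x∉p-x p x x∈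

  three-elements : ∀ {p : Subset n} {x y z} → x ∈ p → y ∈ p → z ∈ p →
                   x ≢ y → x ≢ z → y ≢ z → 2 < ∣ p ∣
  three-elements {p} {x} {y} {z} x∈ y∈ z∈ x≢y x≢z y≢z =
    ≤-trans (s≤s (≤-trans (s≤s (≤-trans (s≤s z≤n) (x∈p⇒∣p-x∣<∣p∣ z∈′))) (x∈p⇒∣p-x∣<∣p∣ y∈′)))
            (x∈p⇒∣p-x∣<∣p∣ x∈)
    where
    y∈′ : y ∈ p - x
    y∈′ = x∈p∧x≢y⇒x∈p-y y∈ (x≢y ∘ sym)
    z∈′ : z ∈ (p - x) - y
    z∈′ = x∈p∧x≢y⇒x∈p-y (x∈p∧x≢y⇒x∈p-y z∈ (x≢z ∘ sym)) (y≢z ∘ sym)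

  subset : {P : Fin n → Set} → Unary.Decidable P → Subset n
  subset P? = tabulate (does ∘ P?)

  ∈-subset : {P : Fin n → Set} (P? : Unary.Decidable P) → ∀ v → v ∈ subset P? ⇔ P v
  ∈-subset P? v = mk⇔ to from
    where
    to : v ∈ subset P? → _
    to v∈ with P? v | trans (sym (lookup∘tabulate (does ∘ P?) v)) ([]=⇒lookup v∈)
    ... | yes Pv | _ = Pv
    from : _ → v ∈ subset P?
    from Pv = lookup⇒[]= v _ (trans (lookup∘tabulate (does ∘ P?) v) (dec-true (P? v) Pv))

-- Cycles and 2-connected subgraphs

module _ {k : ℕ} where

  CyclicSuc? : (i j : Fin k) → Dec (CyclicSuc i j)
  CyclicSuc? i j = (toℕ j ≟ suc (toℕ i)) ⊎-dec (toℕ j ≟ 0 ×-dec suc (toℕ i) ≟ k)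

  CyclicSuc-functional : ∀ {i j j′ : Fin k} → CyclicSuc i j → CyclicSuc i j′ → j ≡ j′
  CyclicSuc-functional (inj₁ p) (inj₁ q) = Fin.toℕ-injective (trans p (sym q))
  CyclicSuc-functional (inj₂ (p , _)) (inj₂ (q , _)) = Fin.toℕ-injective (trans p (sym q))
  CyclicSuc-functional {j = j} (inj₁ p) (inj₂ (_ , q)) = contradiction (Fin.toℕ<n j) (<-irrefl (trans p q))
  CyclicSuc-functional {j′ = j} (inj₂ (_ , q)) (inj₁ p) = contradiction (Fin.toℕ<n j) (<-irrefl (trans p q))

  CyclicSuc-injective : ∀ {i i′ j : Fin k} → CyclicSuc i j → CyclicSuc i′ j → i ≡ i′
  CyclicSuc-injective (inj₁ p) (inj₁ q) = Fin.toℕ-injective (suc-injective (trans (sym p) q))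
  CyclicSuc-injective (inj₂ (_ , p)) (inj₂ (_ , q)) = Fin.toℕ-injective (suc-injective (trans p (sym q)))
  CyclicSuc-injective (inj₁ p) (inj₂ (q , _)) = contradiction (trans (sym q) p) 0≢1+n
  CyclicSuc-injective (inj₂ (q , _)) (inj₁ p) = contradiction (trans (sym q) p) 0≢1+n

  cyclicSuc : (i : Fin k) → ∃[ j ] CyclicSuc i j
  cyclicSuc i with m≤n⇒m<n∨m≡n (Fin.toℕ<n i)
  ... | inj₁ i+1<k = fromℕ< i+1<k , inj₁ (Fin.toℕ-fromℕ< i+1<k)
  ... | inj₂ i+1≡k = fromℕ< 0<k , inj₂ (Fin.toℕ-fromℕ< 0<k , i+1≡k)
    where
    0<k : 0 < k
    0<k = ≤-trans (s≤s z≤n) (Fin.toℕ<n i)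

cyclicPred : ∀ {k} (j : Fin k) → ∃[ i ] CyclicSuc i j
cyclicPred {suc k} zero    = fromℕ k , inj₂ (refl , cong suc (Fin.toℕ-fromℕ k))
cyclicPred {suc k} (suc j) = inject₁ j , inj₁ (cong suc (sym (Fin.toℕ-inject₁ j)))

-- Two indices that follow each other both ways force k ≤ 2.
cyclic-asym : ∀ {k} {i j : Fin k} → 3 ≤ k → CyclicSuc i j → ¬ CyclicSuc j i
cyclic-asym 3≤k (inj₁ p) (inj₁ q) = m≢1+n+m _ {1} (trans q (cong suc p))
cyclic-asym 3≤k (inj₁ p) (inj₂ (q , e)) =
  contradiction 3≤k (<⇒≱ (s≤s (≤-reflexive (trans (sym e) (cong suc (trans p (cong suc q)))))))
cyclic-asym 3≤k (inj₂ (q , e)) (inj₁ p) =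
  contradiction 3≤k (<⇒≱ (s≤s (≤-reflexive (trans (sym e) (cong suc (trans p (cong suc q)))))))
cyclic-asym 3≤k (inj₂ (p , e)) (inj₂ (q , e′)) =
  contradiction 3≤k (<⇒≱ (s≤s (≤-trans (≤-reflexive (trans (sym e) (cong suc q))) (s≤s z≤n))))

module _ {n k : ℕ} {R : Rel (Fin n) 0ℓ} {Ok : Fin k → Set} (c : Fin k → Fin n)
         (edge : ∀ {i j} → CyclicSuc i j → Ok i → Ok j → R (c i) (c j)) where

  -- The recursion is on the number e of steps, none of which wraps around. `Ok` marks the
  -- admissible indices: all of them for a full cycle, all but one for a punctured cycle.
  arc : ∀ e (i j : Fin k) → toℕ i + e ≡ toℕ j →
        (∀ m → toℕ i ≤ toℕ m → toℕ m ≤ toℕ j → Ok m) → Joined R (c i) (c j)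
  arc zero    i j eq ok with refl ← Fin.toℕ-injective (trans (sym (+-identityʳ (toℕ i))) eq) = joined-refl
  arc (suc e) i j eq ok = joined-trans
    (joined-edge (edge (inj₁ i′≡) (ok i ≤-refl i≤j) (ok i′ i≤i′ i′≤j)))
    (arc e i′ j (trans (cong (_+ e) i′≡) i+1+e≡j) (λ m i′≤m → ok m (≤-trans i≤i′ i′≤m)))
    where
    i+1+e≡j : suc (toℕ i) + e ≡ toℕ j
    i+1+e≡j = trans (sym (+-suc (toℕ i) e)) eq
    i<j : toℕ i < toℕ j
    i<j = ≤-trans (m≤m+n _ e) (≤-reflexive i+1+e≡j)
    i≤j : toℕ i ≤ toℕ j
    i≤j = <⇒≤ i<j
    i′ : Fin k
    i′ = fromℕ< (≤-trans (s≤s i<j) (Fin.toℕ<n j))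
    i′≡ : toℕ i′ ≡ suc (toℕ i)
    i′≡ = Fin.toℕ-fromℕ< (≤-trans (s≤s i<j) (Fin.toℕ<n j))
    i≤i′ : toℕ i ≤ toℕ i′
    i≤i′ = ≤-trans (n≤1+n _) (≤-reflexive (sym i′≡))
    i′≤j : toℕ i′ ≤ toℕ j
    i′≤j = ≤-trans (≤-reflexive i′≡) i<j

  arc-≤ : ∀ {i j} → toℕ i ≤ toℕ j → (∀ m → toℕ i ≤ toℕ m → toℕ m ≤ toℕ j → Ok m) → Joined R (c i) (c j)
  arc-≤ {i} {j} i≤j = arc (toℕ j ∸ toℕ i) i j (m+[n∸m]≡n i≤j)

module _ {n : ℕ} {G : Graph n} where
  open Graph G

  cycle⇒2-connected : ∀ {k} {C : Subgraph G} → CycleOfLength k C → TwoConnected C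
  cycle⇒2-connected {suc (suc (suc k))} {C} (_ , c , c-inj , V⇔ , E⇔) =
    three-elements (c∈V zero) (c∈V (suc zero)) (c∈V (suc (suc zero)))
      (c-≢ λ ()) (c-≢ λ ()) (c-≢ λ ()) ,
    ((c zero , c∈V zero) , joined-all) ,
    punctured
    where
    open Subgraph C
    c∈V : ∀ i → c i ∈ V
    c∈V i = Equivalence.from (V⇔ (c i)) (i , refl)
    c-≢ : ∀ {i j} → i ≢ j → c i ≢ c j
    c-≢ i≢j = i≢j ∘ c-inj
    cyclic-E : ∀ {i j} → CyclicSuc i j → E (c i) (c j)
    cyclic-E s = Equivalence.from (E⇔ _ _) (inj₁ s)
    joined-all : ∀ {u v} → u ∈ V → v ∈ V → Joined E u v
    joined-all u∈ v∈ with i , refl ← Equivalence.to (V⇔ _) u∈ | j , refl ← Equivalence.to (V⇔ _) v∈ =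
      joined-trans (joined-sym E-sym (from-0 i)) (from-0 j)
      where
      from-0 : ∀ i → Joined E (c zero) (c i)
      from-0 i = arc-≤ {Ok = λ _ → Unit} c (λ s _ _ → cyclic-E s) z≤n (λ _ _ _ → tt)
    Avoiding : Fin _ → Rel (Fin n) 0ℓ
    Avoiding p u v = E u v × u ≢ c p × v ≢ c p
    Avoiding-sym : ∀ {p} → Symmetric (Avoiding p)
    Avoiding-sym (e , u≢ , v≢) = E-sym e , v≢ , u≢
    edge : ∀ {p i j} → CyclicSuc i j → i ≢ p → j ≢ p → Avoiding p (c i) (c j)
    edge s i≢p j≢p = cyclic-E s , c-≢ i≢p , c-≢ j≢p
    -- Deleting c p leaves a path. If p is zero, everything is reached upwards from index 1.
    -- Otherwise indices below p are reached upwards from 0, and those above p through the closing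
    -- edge from 0 to the last index and then downwards.
    hub : ∀ p → ∃[ b ] b ≢ p × (∀ i → i ≢ p → Joined (Avoiding p) (c b) (c i))
    hub zero    = suc zero , (λ ()) , λ
      { zero    i≢p → contradiction refl i≢p
      ; (suc i) i≢p → arc-≤ c edge (s≤s z≤n) λ { _ () _ refl } }
    hub (suc p) = zero , (λ ()) , from-0
      where
      from-0 : ∀ i → i ≢ suc p → Joined (Avoiding (suc p)) (c zero) (c i)
      from-0 i i≢p with <-cmp (toℕ i) (toℕ (suc p))
      ... | tri< i<p _ _ = arc-≤ c edge z≤n λ { _ _ m≤i refl → <⇒≱ i<p m≤i }
      ... | tri≈ _ i≡p _ = contradiction (Fin.toℕ-injective i≡p) i≢p
      ... | tri> _ _ p<i = joined-trans
        (joined-edge (Avoiding-sym (edge last→0 last≢p (λ ()))))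
        (joined-sym Avoiding-sym (arc-≤ c edge i≤last λ { _ i≤m _ refl → <⇒≱ p<i i≤m }))
        where
        last : Fin _
        last = fromℕ (suc (suc k))
        last→0 : CyclicSuc last zero
        last→0 = inj₂ (refl , cong suc (Fin.toℕ-fromℕ (suc (suc k))))
        i≤last : toℕ i ≤ toℕ last
        i≤last = ≤-trans (s≤s⁻¹ (Fin.toℕ<n i)) (≤-reflexive (sym (Fin.toℕ-fromℕ (suc (suc k)))))
        last≢p : last ≢ suc p
        last≢p eq = <⇒≱ p<i (≤-trans i≤last (≤-reflexive (cong toℕ eq)))
    punctured : ∀ {x} → x ∈ V → ConnectedOn (V - x) (λ u v → E u v × u ≢ x × v ≢ x)
    punctured x∈ with p , refl ← Equivalence.to (V⇔ _) x∈ with b , b≢p , reach ← hub p =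
      (c b , x∈p∧x≢y⇒x∈p-y (c∈V b) (c-≢ b≢p)) , λ u∈ v∈ →
        joined-trans (joined-sym Avoiding-sym (from-b u∈)) (from-b v∈)
      where
      from-b : ∀ {u} → u ∈ V - c p → Joined (Avoiding p) (c b) u
      from-b u∈ with i , refl ← Equivalence.to (V⇔ _) (p─q⊆p V ⁅ c p ⁆ u∈) =
        reach i (λ { refl → x∈p-y⇒x≢y u∈ refl })
  cycle⇒2-connected {1} (s≤s () , _)
  cycle⇒2-connected {2} (s≤s (s≤s ()) , _)

-- Cycles inside cycles, unions and maximal extensions

module _ {n : ℕ} {G : Graph n} where
  open Graph G

  module _ {k : ℕ} {C : Subgraph G} where
    open Subgraph C

    cycle-neighbours : CycleOfLength k C → ∀ {v} → v ∈ V → ∃[ u ] ∃[ w ] u ≢ w × E v u × E v w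
    cycle-neighbours (3≤k , c , c-inj , V⇔ , E⇔) v∈
      with i , refl ← Equivalence.to (V⇔ _) v∈ =
      let j , i→j = cyclicSuc i
          h , h→i = cyclicPred i
      in c j , c h
       , (λ eq → cyclic-asym 3≤k i→j (subst (λ h → CyclicSuc h i) (sym (c-inj eq)) h→i))
       , Equivalence.from (E⇔ i j) (inj₁ i→j)
       , Equivalence.from (E⇔ i h) (inj₂ h→i)

    at-most-two-neighbours : CycleOfLength k C → ∀ {v u w z} → E v u → E v w → u ≢ w → E v z → z ≡ u ⊎ z ≡ w
    at-most-two-neighbours (_ , c , _ , V⇔ , E⇔) vu vw u≢w vz
      with i , refl ← Equivalence.to (V⇔ _) (E-in-V vu)
         | j , refl ← Equivalence.to (V⇔ _) (E-in-V (E-sym vu))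
         | h , refl ← Equivalence.to (V⇔ _) (E-in-V (E-sym vw))
         | l , refl ← Equivalence.to (V⇔ _) (E-in-V (E-sym vz))
      with Equivalence.to (E⇔ i j) vu | Equivalence.to (E⇔ i h) vw | Equivalence.to (E⇔ i l) vz
    ... | inj₁ p | inj₁ q | _      = contradiction (cong c (CyclicSuc-functional p q)) u≢w
    ... | inj₂ p | inj₂ q | _      = contradiction (cong c (CyclicSuc-injective p q)) u≢w
    ... | inj₁ p | inj₂ q | inj₁ r = inj₁ (cong c (CyclicSuc-functional r p))
    ... | inj₁ p | inj₂ q | inj₂ r = inj₂ (cong c (CyclicSuc-injective r q))
    ... | inj₂ p | inj₁ q | inj₁ r = inj₂ (cong c (CyclicSuc-functional r q))
    ... | inj₂ p | inj₁ q | inj₂ r = inj₁ (cong c (CyclicSuc-injective r p))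

  -- At a vertex of H, its two neighbours in H are already all its neighbours in M. So H is closed
  -- under adjacency in M, and connectedness of M makes H exhaust it.
  cycle-in-cycle : ∀ {H M : Subgraph G} {u₀} → Cycle H → Cycle M →
    (∀ {u v} → u ∈ Subgraph.V M → v ∈ Subgraph.V M → Joined (Subgraph.E M) u v) →
    u₀ ∈ Subgraph.V H → H ⊑ M → Subgraph.E M ⇒ Subgraph.E H
  cycle-in-cycle {H} {M} {u₀} (_ , H-cycle) (_ , M-cycle) joined u₀∈H (V⊆ , E⊆) uv =
    local (spread (proj₂ (joined (V⊆ u₀∈H) (M.E-in-V uv))) u₀∈H) uv
    where
    module H = Subgraph H
    module M = Subgraph M
    local : ∀ {u z} → u ∈ H.V → M.E u z → H.E u z
    local u∈ uz with v , w , v≢w , uv , uw ← cycle-neighbours {C = H} H-cycle u∈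
      with at-most-two-neighbours {C = M} M-cycle (E⊆ uv) (E⊆ uw) v≢w uz
    ... | inj₁ refl = uv
    ... | inj₂ refl = uw
    spread : ∀ {k u v} → Walk M.E k u v → u ∈ H.V → v ∈ H.V
    spread []       u∈ = u∈
    spread (uw ∷ p) u∈ = spread p (H.E-in-V (H.E-sym (local u∈ uw)))

  module _ (H K : Subgraph G) where
    private
      module H = Subgraph H
      module K = Subgraph K

    union : Subgraph G
    union = record
      { V      = H.V ∪ K.V
      ; E      = λ u v → H.E u v ⊎ K.E u v
      ; E?     = λ u v → H.E? u v ⊎-dec K.E? u v
      ; E-sym  = Sum.map H.E-sym K.E-sym
      ; E⇒~    = Sum.[ H.E⇒~ , K.E⇒~ ]
      ; E-in-V = x∈p∪q⁺ ∘ Sum.map H.E-in-V K.E-in-V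
      }

  -- If x lies outside H, every walk in H avoids it.
  avoiding-walk : ∀ {H : Subgraph G} → TwoConnected H → ∀ x {u v} →
    u ∈ Subgraph.V H → v ∈ Subgraph.V H → u ≢ x → v ≢ x →
    Joined (λ u v → Subgraph.E H u v × u ≢ x × v ≢ x) u v
  avoiding-walk {H} (_ , (_ , joined) , punctured) x u∈ v∈ u≢x v≢x with x ∈? Subgraph.V H
  ... | yes x∈ = proj₂ (punctured x∈) (x∈p∧x≢y⇒x∈p-y u∈ u≢x) (x∈p∧x≢y⇒x∈p-y v∈ v≢x)
  ... | no x∉  = _ , mapʷ (λ e → e , outside (E-in-V e) , outside (E-in-V (E-sym e))) (proj₂ (joined u∈ v∈))
    where
    open Subgraph H
    outside : ∀ {u} → u ∈ V → u ≢ x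
    outside u∈ refl = x∉ u∈

  -- Of the two common vertices at least one survives the deletion of x, and it links what remains
  -- of H to what remains of K.
  union-2-connected : ∀ {H K : Subgraph G} {y z} → TwoConnected H → TwoConnected K → y ≢ z →
    y ∈ Subgraph.V H → z ∈ Subgraph.V H → y ∈ Subgraph.V K → z ∈ Subgraph.V K →
    TwoConnected (union H K)
  union-2-connected {H} {K} {y} {z} H-2conn@(2<H , (_ , H-joined) , _) K-2conn@(_ , (_ , K-joined) , _)
                    y≢z yH zH yK zK =
    ≤-trans 2<H (∣p∣≤∣p∪q∣ H.V K.V) ,
    ((y , x∈p∪q⁺ (inj₁ yH)) , λ u∈ v∈ → joined-trans (joined-sym U.E-sym (to-y u∈)) (to-y v∈)) ,
    λ {x} _ → punctured x (off x)
    where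
    module H = Subgraph H
    module K = Subgraph K
    module U = Subgraph (union H K)
    to-y : ∀ {u} → u ∈ U.V → Joined U.E y u
    to-y u∈ with x∈p∪q⁻ H.V K.V u∈
    ... | inj₁ uH = _ , mapʷ inj₁ (proj₂ (H-joined yH uH))
    ... | inj₂ uK = _ , mapʷ inj₂ (proj₂ (K-joined yK uK))
    off : ∀ x → ∃[ w ] w ≢ x × w ∈ H.V × w ∈ K.V
    off x with y Fin.≟ x
    ... | no y≢x   = y , y≢x , yH , yK
    ... | yes refl = z , y≢z ∘ sym , zH , zK
    punctured : ∀ x → ∃[ w ] w ≢ x × w ∈ H.V × w ∈ K.V →
                ConnectedOn (U.V - x) (λ u v → U.E u v × u ≢ x × v ≢ x)
    punctured x (w , w≢x , wH , wK) =
      (w , x∈p∧x≢y⇒x∈p-y (x∈p∪q⁺ (inj₁ wH)) w≢x) ,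
      λ u∈ v∈ → joined-trans (joined-sym (λ (e , u≢ , v≢) → U.E-sym e , v≢ , u≢) (to-w u∈)) (to-w v∈)
      where
      to-w : ∀ {u} → u ∈ U.V - x → Joined (λ u v → U.E u v × u ≢ x × v ≢ x) w u
      to-w u∈ with x∈p∪q⁻ H.V K.V (p─q⊆p U.V ⁅ x ⁆ u∈)
      ... | inj₁ uH = _ , mapʷ (λ (e , e′) → inj₁ e , e′)
              (proj₂ (avoiding-walk {H} H-2conn x wH uH w≢x (x∈p-y⇒x≢y u∈)))
      ... | inj₂ uK = _ , mapʷ (λ (e , e′) → inj₂ e , e′)
              (proj₂ (avoiding-walk {K} K-2conn x wK uK w≢x (x∈p-y⇒x≢y u∈)))

  ⊑-trans : ∀ {H K M : Subgraph G} → H ⊑ K → K ⊑ M → H ⊑ M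
  ⊑-trans (V⊆ , E⊆) (V⊆′ , E⊆′) = V⊆′ ∘ V⊆ , E⊆′ ∘ E⊆

  -- A bounded measure that increases strictly with every proper enlargement, by a vertex or by an
  -- edge alone; it makes the search for a maximal subgraph terminate.
  size : Subgraph G → ℕ
  size H = ∣ V ∣ + ∑∑ (λ u v → [ E? u v ]) where open Subgraph H

  size-bound : ℕ
  size-bound = n + ∑∑ {n} (λ _ _ → 1)

  size-≤ : ∀ H → size H ≤ size-bound
  size-≤ H = +-mono-≤ (∣p∣≤n V) (∑∑-mono-≤ λ u v → []-≤1 (E? u v)) where open Subgraph H

  module _ {H K : Subgraph G} (H⊑K : H ⊑ K) where
    private
      module H = Subgraph H
      module K = Subgraph K

    size-<-V : ∀ {v} → v ∈ K.V → v ∉ H.V → size H < size K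
    size-<-V v∈ v∉ = +-mono-<-≤ (p⊂q⇒∣p∣<∣q∣ (proj₁ H⊑K , _ , v∈ , v∉))
      (∑∑-mono-≤ λ u v → []-mono (H.E? u v) (K.E? u v) (proj₂ H⊑K))

    size-<-E : ∀ {u v} → K.E u v → ¬ H.E u v → size H < size K
    size-<-E {u} {v} e ¬e = +-mono-≤-< (p⊆q⇒∣p∣≤∣q∣ (proj₁ H⊑K)) (begin
      suc (∑∑ (λ s t → [ H.E? s t ]))                ≡⟨ cong (_+ _) (∑∑-at u v) ⟨
      ∑∑ (at u v) + ∑∑ (λ s t → [ H.E? s t ])        ≡⟨ ∑∑-+ (at u v) (λ s t → [ H.E? s t ]) ⟨
      ∑∑ (λ s t → at u v s t + [ H.E? s t ])         ≤⟨ ∑∑-mono-≤ extra ⟩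
      ∑∑ (λ s t → [ K.E? s t ])                      ∎)
      where
      open ≤-Reasoning
      extra : ∀ s t → at u v s t + [ H.E? s t ] ≤ [ K.E? s t ]
      extra s t with s Fin.≟ u ×-dec t Fin.≟ v
      ... | no ≢ rewrite at-≢ ≢ = []-mono (H.E? s t) (K.E? s t) (proj₂ H⊑K)
      ... | yes (refl , refl) rewrite at-refl s t | []-no (H.E? s t) ¬e | []-yes (K.E? s t) e = ≤-refl

  -- Stated doubly negated, because maximality quantifies over all subgraphs
  -- and cannot be decided directly.
  maximal-extension : ∀ m (H : Subgraph G) → size-bound < size H + m → TwoConnected H →
    ¬ ¬ (∃[ M ] MaximalTwoConnected M × H ⊑ M)
  maximal-extension zero    H bound H-2conn none = <⇒≱ bound (≤-trans (≤-reflexive (+-identityʳ _)) (size-≤ H))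
  maximal-extension (suc m) H bound H-2conn none =
    -- H itself is maximal: membership and adjacency in H are decidable, and a strictly larger
    -- 2-connected K is refuted by recursion with less room left to grow.
    none (H , (H-2conn , λ K K-2conn H⊑K →
      (λ v∈ → decidable-stable (_ ∈? V) λ v∉ → larger K K-2conn H⊑K (size-<-V {H} {K} H⊑K v∈ v∉)) ,
      (λ e → decidable-stable (E? _ _) λ ¬e → larger K K-2conn H⊑K (size-<-E {H} {K} H⊑K e ¬e))) ,
      id , id)
    where
    open Subgraph H
    larger : ∀ K → TwoConnected K → H ⊑ K → size H < size K → ⊥
    larger K K-2conn H⊑K H<K = maximal-extension m K
      (<-≤-trans bound (≤-trans (≤-reflexive (+-suc (size H) m)) (+-monoˡ-≤ m H<K))) K-2conn
      λ (M , M-max , K⊑M) → none (M , M-max , ⊑-trans {H} {K} {M} H⊑K K⊑M)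

  module _ (cycleBlocks : ∀ (B : Subgraph G) → Block B → Cycle B) where

    -- The union of C and D lies in a maximal 2-connected subgraph, hence in a block and so in a
    -- cycle, which C exhausts. The double negation disappears because adjacency in C is decidable.
    cycles-agree : ∀ {C D : Subgraph G} {y z} → Cycle C → Cycle D → y ≢ z →
      y ∈ Subgraph.V C → z ∈ Subgraph.V C → y ∈ Subgraph.V D → z ∈ Subgraph.V D →
      Subgraph.E D ⇒ Subgraph.E C
    cycles-agree {C} {D} C-cycle@(_ , C′) (_ , D′) y≢z yC zC yD zD e =
      decidable-stable (Subgraph.E? C _ _) λ ¬e →
        maximal-extension (suc size-bound) (union C D) (m≤n+m _ _)
          (union-2-connected {C} {D} (cycle⇒2-connected {C = C} C′) (cycle⇒2-connected {C = D} D′) y≢z yC zC yD zD)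
          λ (M , M-max@((_ , (_ , joined) , _) , _) , V⊆ , E⊆) →
            ¬e (cycle-in-cycle {C} {M} C-cycle (cycleBlocks M (inj₁ M-max)) joined yC
              (V⊆ ∘ p⊆p∪q (Subgraph.V D) , E⊆ ∘ inj₁) (E⊆ (inj₂ e)))

-- Cycles made of two disjoint paths

module _ {n : ℕ} {G : Graph n} where
  open Graph G

  module _ {k : ℕ} (3≤k : 3 ≤ k) (c : Fin k → Fin n) (c-injective : Injective _≡_ _≡_ c)
           (c-~ : ∀ {i j} → CyclicSuc i j → c i ~ c j) where

    private
      image? : Unary.Decidable (λ v → ∃[ i ] c i ≡ v)
      image? v = Fin.any? λ i → c i Fin.≟ v

    -- Only cyclically consecutive vertices are joined, so chords present in G are left out.
    ring : Subgraph G
    ring = record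
      { V      = subset image?
      ; E      = λ u v → ∃[ i ] ∃[ j ] c i ≡ u × c j ≡ v × (CyclicSuc i j ⊎ CyclicSuc j i)
      ; E?     = λ u v → Fin.any? λ i → Fin.any? λ j →
                   c i Fin.≟ u ×-dec c j Fin.≟ v ×-dec (CyclicSuc? i j ⊎-dec CyclicSuc? j i)
      ; E-sym  = λ (i , j , p , q , e) → j , i , q , p , Sum.swap e
      ; E⇒~    = λ { (i , j , refl , refl , inj₁ s) → c-~ s ; (i , j , refl , refl , inj₂ s) → ~-sym (c-~ s) }
      ; E-in-V = λ {u} (i , _ , p , _) → Equivalence.from (∈-subset image? u) (i , p)
      }

    ring-cycle : CycleOfLength k ring
    ring-cycle = 3≤k , c , c-injective , ∈-subset image? , λ i j → mk⇔
      (λ (i′ , j′ , p , q , e) → subst₂ (λ i j → CyclicSuc i j ⊎ CyclicSuc j i) (c-injective p) (c-injective q) e)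
      (λ e → i , j , refl , refl , e)

  -- Disjoint paths P 0, …, P a and Q 0, …, Q b with adjacent first vertices
  -- and adjacent last vertices: together they form a cycle.
  record Arms (P Q : ℕ → Fin n) (a b : ℕ) : Set where
    field
      nontrivial  : 1 ≤ a + b
      P-injective : ∀ {i j} → i ≤ a → j ≤ a → P i ≡ P j → i ≡ j
      Q-injective : ∀ {i j} → i ≤ b → j ≤ b → Q i ≡ Q j → i ≡ j
      P≢Q         : ∀ {i j} → i ≤ a → j ≤ b → P i ≢ Q j
      P-~         : ∀ {i} → i < a → P i ~ P (suc i)
      Q-~         : ∀ {i} → i < b → Q i ~ Q (suc i)
      first-~     : P 0 ~ Q 0
      last-~      : P a ~ Q b

  module ArmsCycle {P Q : ℕ → Fin n} {a b : ℕ} (arms : Arms P Q a b) where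
    open Arms arms

    perimeter : ℕ
    perimeter = suc (a + suc b)

    -- P is traversed forwards at indices 0 to a, then Q backwards: index a + 1 carries Q b and the
    -- last index a + b + 1 carries Q 0.
    vertex : Fin perimeter → Fin n
    vertex i with toℕ i ≤? a
    ... | yes _ = P (toℕ i)
    ... | no _  = Q (a + suc b ∸ toℕ i)

    -- Positions on the two arms. The position on Q is given by a sum rather than by truncated
    -- subtraction, so that it is found by cancellation.
    Low High : Fin perimeter → ℕ → Set
    Low  l i = i ≤ a × toℕ l ≡ i × vertex l ≡ P i
    High l j = j ≤ b × toℕ l + j ≡ a + suc b × vertex l ≡ Q j

    position : ∀ l → (∃[ i ] Low l i) ⊎ (∃[ j ] High l j)
    position l with toℕ l ≤? a
    ... | yes l≤a = inj₁ (toℕ l , l≤a , refl , refl)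
    ... | no l≰a  = inj₂ (j , j≤b , l+j , refl)
      where
      j : ℕ
      j = a + suc b ∸ toℕ l
      l+j : toℕ l + j ≡ a + suc b
      l+j = m+[n∸m]≡n (s≤s⁻¹ (Fin.toℕ<n l))
      j≤b : j ≤ b
      j≤b = +-cancelˡ-≤ (suc a) j b (≤-trans (+-monoˡ-≤ j (≰⇒> l≰a)) (≤-reflexive (trans l+j (+-suc a b))))

    too-short : ∀ {i j} → i ≤ a → j ≤ b → i + j ≢ a + suc b
    too-short i≤a j≤b eq = <-irrefl eq (<-≤-trans (s≤s (+-mono-≤ i≤a j≤b)) (≤-reflexive (sym (+-suc a b))))

    low-index : ∀ {i} → i ≤ a → ∃[ l ] Low l i
    low-index {i} i≤a = l , low (position l)
      where
      i<perimeter : i < perimeter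
      i<perimeter = s≤s (≤-trans i≤a (m≤m+n a _))
      l : Fin perimeter
      l = fromℕ< i<perimeter
      l≡i : toℕ l ≡ i
      l≡i = Fin.toℕ-fromℕ< i<perimeter
      low : (∃[ i ] Low l i) ⊎ (∃[ j ] High l j) → Low l i
      low (inj₁ (_ , _ , l≡ , v))       = i≤a , l≡i , trans v (cong P (trans (sym l≡) l≡i))
      low (inj₂ (j , j≤b , l+j , _)) = contradiction (trans (cong (_+ j) (sym l≡i)) l+j) (too-short i≤a j≤b)

    high-index : ∀ {j} → j ≤ b → ∃[ l ] High l j
    high-index {j} j≤b = l , high (position l)
      where
      l<perimeter : a + suc b ∸ j < perimeter
      l<perimeter = s≤s (m∸n≤m _ j)
      l : Fin perimeter
      l = fromℕ< l<perimeter
      l+j : toℕ l + j ≡ a + suc b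
      l+j = trans (cong (_+ j) (Fin.toℕ-fromℕ< l<perimeter))
                  (m∸n+n≡m (≤-trans j≤b (≤-trans (n≤1+n b) (m≤n+m _ a))))
      high : (∃[ i ] Low l i) ⊎ (∃[ j ] High l j) → High l j
      high (inj₁ (i , i≤a , l≡ , _))  = contradiction (trans (cong (_+ j) (sym l≡)) l+j) (too-short i≤a j≤b)
      high (inj₂ (j′ , _ , l+j′ , v)) = j≤b , l+j , trans v (cong Q (+-cancelˡ-≡ (toℕ l) j′ j (trans l+j′ (sym l+j))))

    -- An ordinary step gives i + j = a + b, and the bounds on i and j then force both equalities.
    -- The wraparound ends at index 0, which is not high.
    low→high : ∀ {l l′ i j} → Low l i → High l′ j → CyclicSuc l l′ → i ≡ a × j ≡ b
    low→high {j = j} (i≤a , refl , _) (j≤b , l′+j , _) (inj₁ l′≡) =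
      i≡a , +-cancelˡ-≡ a j b (trans (cong (_+ j) (sym i≡a)) i+j)
      where
      i+j : _ + j ≡ a + b
      i+j = suc-injective (trans (cong (_+ j) (sym l′≡)) (trans l′+j (+-suc a b)))
      i≡a : _ ≡ a
      i≡a = ≤-antisym i≤a (+-cancelʳ-≤ b a _ (≤-trans (≤-reflexive (sym i+j)) (+-monoʳ-≤ _ j≤b)))
    low→high {j = j} _ (j≤b , l′+j , _) (inj₂ (l′≡0 , _)) =
      contradiction (trans (cong (_+ j) (sym l′≡0)) l′+j) (too-short z≤n j≤b)

    -- An ordinary successor of a high index is too large to be low, so the step is the wraparound.
    high→low : ∀ {l l′ i j} → Low l i → High l′ j → CyclicSuc l′ l → i ≡ 0 × j ≡ 0
    high→low {j = j} (i≤a , refl , _) (j≤b , l′+j , _) (inj₁ l≡) =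
      contradiction l′+j (too-short (≤-trans (n≤1+n _) (≤-trans (≤-reflexive (sym l≡)) i≤a)) j≤b)
    high→low {l′ = l′} {j = j} (i≤a , refl , _) (j≤b , l′+j , _) (inj₂ (l≡0 , l′≡)) =
      l≡0 , +-cancelˡ-≡ (toℕ l′) j 0 (trans l′+j (trans (sym (suc-injective l′≡)) (sym (+-identityʳ _))))

    vertex-injective : Injective _≡_ _≡_ vertex
    vertex-injective {l} {l′} eq with position l | position l′
    ... | inj₁ (i , i≤a , refl , v) | inj₁ (i′ , i′≤a , refl , v′) =
      Fin.toℕ-injective (P-injective i≤a i′≤a (trans (sym v) (trans eq v′)))
    ... | inj₁ (i , i≤a , _ , v) | inj₂ (j , j≤b , _ , v′) = contradiction (trans (sym v) (trans eq v′)) (P≢Q i≤a j≤b)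
    ... | inj₂ (j , j≤b , _ , v) | inj₁ (i , i≤a , _ , v′) = contradiction (trans (sym v′) (trans (sym eq) v)) (P≢Q i≤a j≤b)
    ... | inj₂ (j , j≤b , l+j , v) | inj₂ (j′ , j′≤b , l′+j′ , v′)
      with refl ← Q-injective j≤b j′≤b (trans (sym v) (trans eq v′)) =
      Fin.toℕ-injective (+-cancelʳ-≡ j (toℕ l) (toℕ l′) (trans l+j (sym l′+j′)))

    vertex-~ : ∀ {l l′} → CyclicSuc l l′ → vertex l ~ vertex l′
    vertex-~ {l} {l′} s with position l | position l′
    ... | inj₁ (_ , low@(_ , _ , v)) | inj₂ (_ , high@(_ , _ , v′))
      with refl , refl ← low→high low high s = subst₂ _~_ (sym v) (sym v′) last-~
    ... | inj₂ (_ , high@(_ , _ , v)) | inj₁ (_ , low@(_ , _ , v′))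
      with refl , refl ← high→low low high s = subst₂ _~_ (sym v) (sym v′) (~-sym first-~)
    ... | inj₁ (i , i≤a , refl , v) | inj₁ (i′ , i′≤a , refl , v′) with s
    ...   | inj₁ l′≡ = subst₂ _~_ (sym v) (trans (cong P (sym l′≡)) (sym v′)) (P-~ (subst (_≤ a) l′≡ i′≤a))
    ...   | inj₂ (_ , l≡) = contradiction i≤a
      (<⇒≱ (≤-trans (≤-trans (≤-reflexive (sym (+-comm a 1))) (+-monoʳ-≤ a (s≤s z≤n))) (≤-reflexive (sym (suc-injective l≡)))))
    vertex-~ {l} {l′} s | inj₂ (j , j≤b , l+j , v) | inj₂ (j′ , j′≤b , l′+j′ , v′) with s
    ...   | inj₂ (l′≡0 , _) = contradiction (trans (cong (_+ j′) (sym l′≡0)) l′+j′) (too-short z≤n j′≤b)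
    ...   | inj₁ l′≡ with refl ← +-cancelˡ-≡ (toℕ l) j (suc j′)
              (trans l+j (trans (sym l′+j′) (trans (cong (_+ j′) l′≡) (sym (+-suc (toℕ l) j′)))))
            = subst₂ _~_ (sym v) (sym v′) (~-sym (Q-~ j≤b))

    3≤perimeter : 3 ≤ perimeter
    3≤perimeter = s≤s (≤-trans (s≤s nontrivial) (≤-reflexive (sym (+-suc a b))))

    cycle : Subgraph G
    cycle = ring 3≤perimeter vertex vertex-injective vertex-~

    isCycle : CycleOfLength perimeter cycle
    isCycle = ring-cycle 3≤perimeter vertex vertex-injective vertex-~

    open Subgraph cycle

    vertex∈ : ∀ l → vertex l ∈ V
    vertex∈ l = let _ , _ , _ , V⇔ , _ = isCycle in Equivalence.from (V⇔ (vertex l)) (l , refl)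

    P-last∈ : P a ∈ V
    P-last∈ with l , _ , _ , v ← low-index {a} ≤-refl = subst (_∈ V) v (vertex∈ l)

    Q-last∈ : Q b ∈ V
    Q-last∈ with l , _ , _ , v ← high-index {b} ≤-refl = subst (_∈ V) v (vertex∈ l)

    first-E : E (P 0) (Q 0)
    first-E with l , _ , l≡0 , v ← low-index {0} z≤n | l′ , _ , l′+0 , v′ ← high-index {0} z≤n =
      l , l′ , v , v′ , inj₂ (inj₂ (l≡0 , cong suc (trans (sym (+-identityʳ _)) l′+0)))

    -- An edge of the cycle leaving S goes from the arm P to the arm Q, and only the two joining
    -- edges do so.
    crossing-edges : ∀ {S : Fin n → Set} → (∀ {i} → i ≤ a → S (P i)) → (∀ {j} → j ≤ b → ¬ S (Q j)) →
      ∀ {u v} → E u v → S u → ¬ S v → (u ≡ P a × v ≡ Q b) ⊎ (u ≡ P 0 × v ≡ Q 0)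
    crossing-edges {S} P⊆S Q∩S=∅ (l , l′ , refl , refl , s) Su ¬Sv with position l | position l′
    ... | inj₂ (_ , j≤b , _ , v) | _ = contradiction (subst S v Su) (Q∩S=∅ j≤b)
    ... | inj₁ _ | inj₁ (_ , i≤a , _ , v) = contradiction (subst S (sym v) (P⊆S i≤a)) ¬Sv
    ... | inj₁ (_ , low@(_ , _ , v)) | inj₂ (_ , high@(_ , _ , v′)) with s
    ...   | inj₁ l→l′ with refl , refl ← low→high low high l→l′ = inj₁ (v , v′)
    ...   | inj₂ l′→l with refl , refl ← high→low low high l′→l = inj₂ (v , v′)

-- Geodesic cycles and the upper bound for even cycles

module _ {n : ℕ} {G : Graph n} (connected : Connected G) where
  open Graph G
  open Metric G connected

  -- Induction on d(x, s). If the geodesics from s and t to x meet before x, they do so after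
  -- equally many steps, and the meeting point is a counterexample at smaller distance. Otherwise
  -- they close up with st to a cycle of length 2 d(x, s) + 1.
  even-cycles⇒tilted : (∀ (C : Subgraph G) k → CycleOfLength k C → 2 ∣ k) → EdgesTilted G connected
  even-cycles⇒tilted even x {s} {t} s~t ds≡dt = go (<-wellFounded (d x s)) x refl s~t ds≡dt
    where
    go : ∀ {m} → Acc _<_ m → ∀ x {s t} → d x s ≡ m → s ~ t → d x s ≢ d x t
    go {zero}  _         x d≡0 s~t ds≡dt = ~-irrefl (trans (sym (d≡0⇒≡ d≡0)) (d≡0⇒≡ (trans (sym ds≡dt) d≡0))) s~t
    go {suc b} (acc rec) x {s} {t} ds s~t ds≡dt = odd (even cycle perimeter isCycle)
      where
      dt : d x t ≡ suc b
      dt = trans (sym ds≡dt) ds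
      ≤s : ∀ {i} → i ≤ suc b → i ≤ d x s
      ≤s i≤ = ≤-trans i≤ (≤-reflexive (sym ds))
      ≤t : ∀ {i} → i ≤ suc b → i ≤ d x t
      ≤t i≤ = ≤-trans i≤ (≤-reflexive (sym dt))
      P Q : ℕ → Fin n
      P = geodesic x s
      Q = geodesic x t
      d-back : ∀ {u i} → i ≤ d x u → d (geodesic x u i) u ≡ i
      d-back {u} {i} i≤ = ≤-antisym
        (≤-trans (≤-reflexive (d-sym (geodesic x u i) u)) (d-along-geodesic x u i i≤))
        (+-cancelˡ-≤ (d x (geodesic x u i)) i _
          (≤-trans (≤-reflexive (geodesic-d x u i i≤)) (d-triangle x (geodesic x u i) u)))
      disjoint : ∀ {i j} → i ≤ suc b → j ≤ b → P i ≢ Q j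
      disjoint {i} {j} i≤ j≤b eq = go (rec (s≤s i≤b)) (P i) (d-back (≤s i≤)) s~t
        (trans (d-back (≤s i≤)) (trans i≡j (sym (trans (cong (λ w → d w t) eq) (d-back (≤t j≤))))))
        where
        j≤ : j ≤ suc b
        j≤ = ≤-trans j≤b (n≤1+n b)
        i≡j : i ≡ j
        i≡j = +-cancelˡ-≡ (d x (P i)) i j (trans (geodesic-d x s i (≤s i≤))
          (trans ds≡dt (trans (sym (geodesic-d x t j (≤t j≤))) (cong (λ w → d x w + j) (sym eq)))))
        i≤b : i ≤ b
        i≤b = ≤-trans (≤-reflexive i≡j) j≤b
      -- P runs as far as x, while Q stops one step short of it, so that x occurs once on the cycle.
      arms : Arms {G = G} P Q (suc b) b
      arms = record
        { nontrivial  = s≤s z≤n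
        ; P-injective = λ i≤ j≤ → geodesic-injective x s (≤s i≤) (≤s j≤)
        ; Q-injective = λ i≤ j≤ → geodesic-injective x t (≤t (m≤n⇒m≤1+n i≤)) (≤t (m≤n⇒m≤1+n j≤))
        ; P≢Q         = disjoint
        ; P-~         = λ i< → geodesic-~ x s _ (≤s i<)
        ; Q-~         = λ i< → geodesic-~ x t _ (≤t (m≤n⇒m≤1+n i<))
        ; first-~     = s~t
        ; last-~      = subst (_~ Q b) (trans (end dt) (sym (end ds))) (~-sym (geodesic-~ x t b (≤t ≤-refl)))
        }
        where
        end : ∀ {u} → d x u ≡ suc b → geodesic x u (suc b) ≡ x
        end {u} du = trans (cong (geodesic x u) (sym du)) (geodesic-end x u)
      open ArmsCycle arms
      odd : ¬ 2 ∣ suc (suc b + suc b)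
      odd 2∣ = contradiction (∣m+n∣m⇒∣n (subst (2 ∣_) (sym (+-comm (suc b + suc b) 1)) 2∣)
                                        (divides (suc b) (trans (cong (suc b +_) (sym (+-identityʳ _))) (*-comm 2 (suc b)))))
                             (λ 2∣1 → <⇒≱ ≤-refl (∣⇒≤ 2∣1))

  -- The edge st joins the side of y to the side of y′.
  Cross : Fin n → Fin n → Fin n → Fin n → Set
  Cross y y′ s t = s ~ t × d y s < d y′ s × d y′ t < d y t

  -- After i steps the distance to y has dropped by exactly i and the distance to y′ by at most i.
  geodesic-stays : ∀ {y y′ s i} → d y s < d y′ s → i ≤ d y s → d y (geodesic y s i) < d y′ (geodesic y s i)
  geodesic-stays {y} {y′} {s} {i} closer i≤ = +-cancelʳ-< i (d y w) (d y′ w) (begin-strict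
    d y w + i         ≡⟨ geodesic-d y s i i≤ ⟩
    d y s             <⟨ closer ⟩
    d y′ s            ≤⟨ d-triangle y′ w s ⟩
    d y′ w + d w s    ≡⟨ cong (d y′ w +_) (d-sym w s) ⟩
    d y′ w + d s w    ≤⟨ +-monoʳ-≤ (d y′ w) (d-along-geodesic y s i i≤) ⟩
    d y′ w + i        ∎)
    where
    open ≤-Reasoning
    w : Fin n
    w = geodesic y s i

  -- Each geodesic stays on its own side of yy′, so the two are disjoint. They are both trivial only
  -- when st is yy′ itself.
  cross-arms : ∀ {y y′ s t} → y ~ y′ → Cross y y′ s t → ¬ (s ≡ y × t ≡ y′) →
    Arms {G = G} (geodesic y s) (geodesic y′ t) (d y s) (d y′ t)
  cross-arms {y} {y′} {s} {t} y~y′ (s~t , ys<y′s , y′t<yt) ≢ = record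
    { nontrivial  = n≢0⇒n>0 λ eq → ≢
        ( sym (d≡0⇒≡ (m+n≡0⇒m≡0 (d y s) eq))
        , sym (d≡0⇒≡ (m+n≡0⇒n≡0 (d y s) eq)))
    ; P-injective = geodesic-injective y s
    ; Q-injective = geodesic-injective y′ t
    ; P≢Q         = λ i≤ j≤ eq → <-asym (geodesic-stays ys<y′s i≤)
        (subst (λ w → d y′ w < d y w) (sym eq) (geodesic-stays y′t<yt j≤))
    ; P-~         = geodesic-~ y s _
    ; Q-~         = geodesic-~ y′ t _
    ; first-~     = s~t
    ; last-~      = subst₂ _~_ (sym (geodesic-end y s)) (sym (geodesic-end y′ t)) y~y′
    }

  module _ (cycleBlocks : ∀ (B : Subgraph G) → Block B → Cycle B) where

    -- Both geodesic cycles pass through y and y′, so s′t′ is also an edge of the first cycle. There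
    -- it crosses between the sides, which leaves only yy′ and st.
    cross-unique : ∀ {y y′ s t s′ t′} → y ~ y′ →
      Cross y y′ s t → ¬ (s ≡ y × t ≡ y′) → Cross y y′ s′ t′ → ¬ (s′ ≡ y × t′ ≡ y′) →
      s′ ≡ s × t′ ≡ t
    cross-unique {y} {y′} {s} {t} {s′} {t′} y~y′ e@(_ , ys<y′s , y′t<yt) new e′@(_ , ys′<y′s′ , y′t′<yt′) new′ =
      other (C.crossing-edges {S} (geodesic-stays ys<y′s) (λ j≤ → <-asym (geodesic-stays y′t<yt j≤))
        s′t′∈C ys′<y′s′ (<-asym y′t′<yt′))
      where
      module C = ArmsCycle (cross-arms y~y′ e new)
      module D = ArmsCycle (cross-arms y~y′ e′ new′)
      S : Fin n → Set
      S w = d y w < d y′ w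
      y≢y′ : y ≢ y′
      y≢y′ refl = ~-irrefl refl y~y′
      s′t′∈C : Subgraph.E C.cycle s′ t′
      s′t′∈C = cycles-agree cycleBlocks {C.cycle} {D.cycle} (C.perimeter , C.isCycle) (D.perimeter , D.isCycle) y≢y′
        (subst (_∈ Subgraph.V C.cycle) (geodesic-end y s) C.P-last∈)
        (subst (_∈ Subgraph.V C.cycle) (geodesic-end y′ t) C.Q-last∈)
        (subst (_∈ Subgraph.V D.cycle) (geodesic-end y s′) D.P-last∈)
        (subst (_∈ Subgraph.V D.cycle) (geodesic-end y′ t′) D.Q-last∈)
        D.first-E
      other : (s′ ≡ geodesic y s (d y s) × t′ ≡ geodesic y′ t (d y′ t)) ⊎ (s′ ≡ s × t′ ≡ t) → s′ ≡ s × t′ ≡ t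
      other (inj₁ (p , q)) = contradiction (trans p (geodesic-end y s) , trans q (geodesic-end y′ t)) new′
      other (inj₂ eqs)     = eqs

    second-cross : ∀ {y y′} → y ~ y′ → ∃[ p ] ∃[ q ] ∀ s t → Cross y y′ s t →
      (s ≡ y × t ≡ y′) ⊎ (s ≡ p × t ≡ q)
    second-cross {y} {y′} y~y′ with Fin.any? (λ s → Fin.any? λ t →
        (s ~? t ×-dec d y s <? d y′ s ×-dec d y′ t <? d y t) ×-dec ¬? (s Fin.≟ y ×-dec t Fin.≟ y′))
    ... | yes (p , q , e , new) = p , q , λ s t e′ → decide s t e′
      where
      decide : ∀ s t → Cross y y′ s t → (s ≡ y × t ≡ y′) ⊎ (s ≡ p × t ≡ q)
      decide s t e′ with s Fin.≟ y ×-dec t Fin.≟ y′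
      ... | yes eqs = inj₁ eqs
      ... | no new′   = inj₂ (cross-unique y~y′ e new e′ new′)
    -- With no second crossing edge, yy′ is repeated as a default value.
    ... | no none = y , y′ , λ s t e → inj₁ (decidable-stable (s Fin.≟ y ×-dec t Fin.≟ y′)
      λ new → none (s , t , e , new))

    module _ (tilted : EdgesTilted G connected) where

      -- The factor 1 - f(y) increases only when s is the end nearer to y and t the end nearer to
      -- y′. It then goes from 0 to 2 against a factor of at most 2, so each of at most two oriented
      -- edges adds at most 4.
      contribution-step : ∀ x {y y′} → y ~ y′ → contribution x y′ ≤ contribution x y + 8
      contribution-step x {y} {y′} y~y′ with p , q , only ← second-cross y~y′ = begin
        contribution x y′
          ≤⟨ ∑∑-mono-≤ (λ s t → term s t (only s t)) ⟩
        ∑∑ (λ s t → h s t + (4 * at y y′ s t + 4 * at p q s t))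
          ≡⟨ ∑∑-+ h (λ s t → 4 * at y y′ s t + 4 * at p q s t) ⟩
        contribution x y + ∑∑ (λ s t → 4 * at y y′ s t + 4 * at p q s t)
          ≡⟨ cong (contribution x y +_) (∑∑-+ (λ s t → 4 * at y y′ s t) (λ s t → 4 * at p q s t)) ⟩
        contribution x y + (∑∑ (λ s t → 4 * at y y′ s t) + ∑∑ (λ s t → 4 * at p q s t))
          ≡⟨ cong (contribution x y +_) (cong₂ _+_ (four y y′) (four p q)) ⟩
        contribution x y + 8 ∎
        where
        open ≤-Reasoning
        h : Fin n → Fin n → ℕ
        h s t = [ s ~? t ] * (tilt x s t * tilt y t s)
        four : ∀ a b → ∑∑ (λ s t → 4 * at a b s t) ≡ 4
        four a b = trans (∑∑-* 4 (at a b)) (cong (4 *_) (∑∑-at a b))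
        term : ∀ {p q} s t → (Cross y y′ s t → (s ≡ y × t ≡ y′) ⊎ (s ≡ p × t ≡ q)) →
          [ s ~? t ] * (tilt x s t * tilt y′ t s) ≤ h s t + (4 * at y y′ s t + 4 * at p q s t)
        term {p} {q} s t only with s ~? t
        ... | no _    = z≤n
        ... | yes s~t with <-cmp (d y s) (d y t) | <-cmp (d y′ s) (d y′ t)
        ...   | tri≈ _ eq _  | _              = contradiction eq (tilted y s~t)
        ...   | _            | tri≈ _ eq _    = contradiction eq (tilted y′ s~t)
        ...   | _            | tri< s<t _ _ rewrite m≤n⇒m∸n≡0 s<t | *-zeroʳ (tilt x s t) = z≤n
        ...   | tri> _ _ t<s | tri> _ _ t<′s = ≤-trans
          (*-monoʳ-≤ 1 (*-monoʳ-≤ (tilt x s t) (≤-trans (tilt-≤2 y′ (~-sym s~t)) two)))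
          (m≤m+n _ _)
          where
          two : 2 ≤ tilt y t s
          two = ≤-trans (≤-reflexive (sym (m+n∸n≡m 2 (d y t)))) (∸-monoˡ-≤ (d y t) (s≤s t<s))
        ...   | tri< s<t _ _ | tri> _ _ t<′s = ≤-trans
          (*-monoʳ-≤ 1 (*-mono-≤ (tilt-≤2 x s~t) (tilt-≤2 y′ (~-sym s~t))))
          (≤-trans (four-≤ (only (s~t , s-side , t-side))) (m≤n+m _ (1 * (tilt x s t * tilt y t s))))
          where
          -- Here d(y, s) < d(y, t) ≤ d(y′, t) + 1, so d(y, s) ≤ d(y′, t) < d(y′, s). This turns a
          -- comparison of the ends of st into one between y and y′.
          s-side : d y s < d y′ s
          s-side = <-≤-trans (s≤s (s≤s⁻¹ (≤-trans s<t (≤-trans (≤-reflexive (d-sym y t))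
            (≤-trans (d-step t (~-sym y~y′)) (s≤s (≤-reflexive (d-sym t y′)))))))) t<′s
          t-side : d y′ t < d y t
          t-side = <-≤-trans (s≤s (s≤s⁻¹ (≤-trans t<′s (≤-trans (≤-reflexive (d-sym y′ s))
            (≤-trans (d-step s y~y′) (s≤s (≤-reflexive (d-sym s y)))))))) s<t
          four-≤ : (s ≡ y × t ≡ y′) ⊎ (s ≡ p × t ≡ q) → 4 ≤ 4 * at y y′ s t + 4 * at p q s t
          four-≤ (inj₁ (refl , refl)) rewrite at-refl s t = m≤m+n 4 _
          four-≤ (inj₂ (refl , refl)) rewrite at-refl s t = m≤n+m 4 _

      contribution-along : ∀ x {k u v} → Walk _~_ k u v → contribution x v ≤ contribution x u + 8 * k
      contribution-along x {u = u} [] = ≤-reflexive (sym (+-identityʳ (contribution x u)))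
      contribution-along x {suc k} {u} {v} (_∷_ {v = w} u~w p) = begin
        contribution x v                 ≤⟨ contribution-along x p ⟩
        contribution x w + 8 * k         ≤⟨ +-monoˡ-≤ (8 * k) (contribution-step x u~w) ⟩
        contribution x u + 8 + 8 * k     ≡⟨ +-assoc (contribution x u) 8 (8 * k) ⟩
        contribution x u + (8 + 8 * k)   ≡⟨ cong (contribution x u +_) (*-suc 8 k) ⟨
        contribution x u + 8 * suc k     ∎
        where open ≤-Reasoning

      contribution-≤ : ∀ x y → contribution x y ≤ 8 * d x y
      contribution-≤ x y = subst (λ c → contribution x y ≤ c + 8 * d x y)
        (tilted⇒contribution-diagonal-0 G connected tilted x) (contribution-along x (shortestWalk x y))

    -- Comparison of the two indices

    octuple-distances : 2 * (8 * Wiener G) ≡ ∑∑ (λ x y → 8 * d x y)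
    octuple-distances = begin
      2 * (8 * Wiener G)        ≡⟨ *-assoc 2 8 (Wiener G) ⟨
      2 * 8 * Wiener G          ≡⟨ *-assoc 8 2 (Wiener G) ⟩
      8 * (2 * Wiener G)        ≡⟨ cong (8 *_) double-Wiener ⟩
      8 * ∑∑ d                  ≡⟨ ∑∑-* 8 d ⟨
      ∑∑ (λ x y → 8 * d x y)    ∎
      where open ≡-Reasoning

    octuple-Wiener-≤ : 8 * Wiener G ≤ ∑∑ (szegedSummand G)
    octuple-Wiener-≤ = *-cancelˡ-≤ 2 (begin
      2 * (8 * Wiener G)        ≡⟨ octuple-distances ⟩
      ∑∑ (λ x y → 8 * d x y)    ≤⟨ ∑∑-mono-≤ (contribution-≥ cycleBlocks connected) ⟩
      ∑∑ contribution           ≡⟨ double-szeged ⟨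
      2 * ∑∑ (szegedSummand G)  ∎)
      where open ≤-Reasoning

    -- Equal sums force equality in every term; the diagonal terms give F(x, x) = 8 d(x, x) = 0.
    octuple-Wiener-≡⇒even-cycles : 8 * Wiener G ≡ ∑∑ (szegedSummand G) →
      ∀ (C : Subgraph G) k → CycleOfLength k C → 2 ∣ k
    octuple-Wiener-≡⇒even-cycles eq = tilted⇒even-cycles G connected
      (contribution-diagonal-0⇒tilted G connected λ x →
        trans (sym (pointwise x x)) (cong (8 *_) (d-refl x)))
      where
      pointwise : ∀ x y → 8 * d x y ≡ contribution x y
      pointwise = ∑∑-mono-≤-≡ (contribution-≥ cycleBlocks connected)
        (trans (sym octuple-distances) (trans (cong (2 *_) eq) double-szeged))

    even-cycles⇒octuple-Wiener-≡ : (∀ (C : Subgraph G) k → CycleOfLength k C → 2 ∣ k) →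
      8 * Wiener G ≡ ∑∑ (szegedSummand G)
    even-cycles⇒octuple-Wiener-≡ even = *-cancelˡ-≡ _ _ 2
      (trans octuple-distances (trans (∑∑-cong pointwise) (sym double-szeged)))
      where
      pointwise : ∀ x y → 8 * d x y ≡ contribution x y
      pointwise x y = ≤-antisym (contribution-≥ cycleBlocks connected x y)
        (contribution-≤ (even-cycles⇒tilted even) x y)

theorem4p2 : ∀ {n : ℕ} (G : Graph n) → Connected G →
    (∀ (B : Subgraph G) → Block B → Cycle B) →
    (⟦ 2 ⟧ ℚ.* ⟦ Wiener G ⟧ ℚ.≤ RevisedSzeged G)
    × ((⟦ 2 ⟧ ℚ.* ⟦ Wiener G ⟧ ≡ RevisedSzeged G)
    ⇔ (∀ (C : Subgraph G) (k : ℕ) → CycleOfLength k C → 2 ∣ k))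
theorem4p2 G connected cycleBlocks =
  subst₂ ℚ._≤_ (sym (quarter-of-octuple (Wiener G))) (sym (RevisedSzeged-quarter G))
    (¼-mono-≤ (octuple-Wiener-≤ connected cycleBlocks)) ,
  mk⇔
    (λ eq → octuple-Wiener-≡⇒even-cycles connected cycleBlocks
      (¼-cancel (trans (sym (quarter-of-octuple (Wiener G))) (trans eq (RevisedSzeged-quarter G)))))
    (λ even → trans (quarter-of-octuple (Wiener G))
      (trans (cong (λ k → ¼ ℚ.* ⟦ k ⟧) (even-cycles⇒octuple-Wiener-≡ connected cycleBlocks even))
             (sym (RevisedSzeged-quarter G))))
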